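{- Every graph in $\varepsilon_{23}$ is planar.
   Context: All graphs are finite, simple and connected. An Euler graph is a connected graph all of whose nodes have even degree. $\varepsilon_{23}$ is the class of Euler graphs in which every cycle has length $\equiv 2$ or $\equiv 3\pmod 4$ and which contain at least one cycle of each of these two kinds. -}

module Defs where

open import Data.Bool using (Bool; true; false; if_then_else_)
open import Data.Nat using (ℕ; zero; suc; _≤_; _<_; _%_)
open import Data.Nat.Divisibility using (_∣_)
open import Data.Fin using (Fin; toℕ)
open import Data.List using (List; []; _∷_; _++_; length; map; allFin; lookup)
open import Data.Nat.ListAction using (sum)
open import Data.List.Relation.Unary.Any using (Any)
open import Data.List.Relation.Unary.All using (All)
open import Data.List.Relation.Unary.Linked using (Linked)
open import Data.List.Relation.Unary.Unique.Propositional using (Unique)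
open import Data.Product using (Σ; _×_; _,_; proj₁; proj₂)
open import Data.Sum using (_⊎_)
open import Data.Empty using (⊥)
open import Relation.Nullary using (¬_)
open import Relation.Binary.PropositionalEquality using (_≡_; _≢_)
open import Data.Rational using (ℚ; 0ℚ; 1ℚ; _+_; _*_; _-_) renaming (_≤_ to _≤ℚ_)

record Graph : Set where
  field
    n          : ℕ
    adj        : Fin n → Fin n → Bool
    adj-sym    : ∀ u v → adj u v ≡ adj v u
    adj-irrefl : ∀ u → adj u u ≡ false

module _ (G : Graph) where
  open Graph G

  Adj : Fin n → Fin n → Set
  Adj u v = adj u v ≡ true

  data Walk : Fin n → Fin n → Set where
    []  : ∀ {u} → Walk u u
    _∷_ : ∀ {u w v} → Adj u w → Walk w v → Walk u v

  Connected : Set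
  Connected = ∀ u v → Walk u v

  degree : Fin n → ℕ
  degree u = sum (map (λ v → if adj u v then 1 else 0) (allFin n))

  IsEuler : Set
  IsEuler = Connected × (∀ u → 2 ∣ degree u)

  lastOf : Fin n → List (Fin n) → Fin n
  lastOf v []       = v
  lastOf v (w ∷ ws) = lastOf w ws

  closingEdge : List (Fin n) → Set
  closingEdge []       = ⊥
  closingEdge (v ∷ vs) = Adj (lastOf v vs) v

  record Cycle : Set where
    field
      verts    : List (Fin n)
      long     : 3 ≤ length verts
      distinct : Unique verts
      path     : Linked Adj verts
      closed   : closingEdge verts

  cycleLength : Cycle → ℕ
  cycleLength c = length (Cycle.verts c)

  Inε23 : Set
  Inε23 = IsEuler
        × (∀ (c : Cycle) → (cycleLength c % 4 ≡ 2) ⊎ (cycleLength c % 4 ≡ 3))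
        × Σ Cycle (λ c → cycleLength c % 4 ≡ 2)
        × Σ Cycle (λ c → cycleLength c % 4 ≡ 3)

Point : Set
Point = ℚ × ℚ

OnSeg : Point → Point → Point → Set
OnSeg (x₁ , x₂) (a₁ , a₂) (b₁ , b₂) =
  Σ ℚ λ t → (0ℚ ≤ℚ t) × (t ≤ℚ 1ℚ)
          × (x₁ ≡ a₁ + t * (b₁ - a₁)) × (x₂ ≡ a₂ + t * (b₂ - a₂))

segs : List Point → List (Point × Point)
segs (p ∷ q ∷ rest) = (p , q) ∷ segs (q ∷ rest)
segs _              = []

OnSegment : Point → Point × Point → Set
OnSegment x s = OnSeg x (proj₁ s) (proj₂ s)

OnPoly : Point → List Point → Set
OnPoly x ps = Any (OnSegment x) (segs ps)

SimplePoly : List Point → Set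
SimplePoly ps =
  All (λ s → proj₁ s ≢ proj₂ s) (segs ps)
  × (∀ (i j : Fin (length (segs ps))) → toℕ i < toℕ j →
       (toℕ j ≡ suc (toℕ i) → ∀ x → OnSegment x (lookup (segs ps) i)
                                  → OnSegment x (lookup (segs ps) j)
                                  → x ≡ proj₂ (lookup (segs ps) i))
     × (suc (toℕ i) < toℕ j → ∀ x → ¬ (OnSegment x (lookup (segs ps) i)
                                       × OnSegment x (lookup (segs ps) j))))

module _ (G : Graph) where
  open Graph G

  arc : (Fin n → Point) → (Fin n → Fin n → List Point) → Fin n → Fin n → List Point
  arc pos bends u v = pos u ∷ (bends u v ++ (pos v ∷ []))

  -- edges listed once, as u < v
  Edge : Fin n → Fin n → Set
  Edge u v = (toℕ u < toℕ v) × Adj G u v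

  record PlaneDrawing : Set where
    field
      pos      : Fin n → Point
      pos-inj  : ∀ u v → pos u ≡ pos v → u ≡ v
      bends    : Fin n → Fin n → List Point
      arc-simple : ∀ u v → Edge u v → SimplePoly (arc pos bends u v)
      arc-avoids : ∀ u v w → Edge u v → OnPoly (pos w) (arc pos bends u v)
                   → (w ≡ u) ⊎ (w ≡ v)
      arcs-disjoint : ∀ u v u′ v′ → Edge u v → Edge u′ v′ → ¬ ((u ≡ u′) × (v ≡ v′))
                      → ∀ x → OnPoly x (arc pos bends u v) → OnPoly x (arc pos bends u′ v′)
                      → Σ (Fin n) λ w → ((w ≡ u) ⊎ (w ≡ v)) × ((w ≡ u′) ⊎ (w ≡ v′)) × (x ≡ pos w)

  Planar : Set
  Planar = PlaneDrawing

{-# OPTIONS --safe #-}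

-- A subdivision of K₄ contains seven cycles whose lengths add up to four times the number of its
-- edges.  Either none or exactly four of them are odd, so lengths ≡ 2, 3 (mod 4) would add up to
-- 14 or 18, which is ≡ 2 (mod 4); hence the graph contains no subdivision of K₄.
--
-- Such a graph has a vertex of degree at most two.  Consider a path with end h whose neighbours all
-- lie on it, among them c and, further away, d.  Rotating the path at c makes the predecessor g of c
-- the new end.  A neighbour of g at or beyond d would give a subdivided K₄ on h, g, c, d; therefore
-- the neighbours of the end move ever closer to it, and this process cannot go on.
--
-- So the graph is dismantled by deleting pendant edges, merging parallel edges and suppressing
-- vertices of degree two, where edges carry lengths so that the cycle condition survives.  A weak
-- visibility representation (horizontal bars for vertices, vertical segments for edges) is rebuilt
-- along the way back, and bending each vertical segment near its two ends towards fixed points of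
-- the bars gives the plane drawing.
module Submission where

open import Defs
open import Data.Bool using (true)
import Data.Bool.Properties as Boolₚ
open import Data.Empty using (⊥; ⊥-elim)
open import Data.Fin using (Fin; zero; suc; toℕ; fromℕ<; #_)
import Data.Fin.Properties as Finₚ
open import Data.List using (List; []; _∷_; _++_; length; map; concat; lookup; reverse; filter; allFin;
  cartesianProduct)
open import Data.List.Properties using (++-assoc; ++-identityʳ; length-++; length-reverse; unfold-reverse)
import Data.List.Membership.DecPropositional as DecMembership
open import Data.List.Membership.Propositional using (_∈_; _∉_)
open import Data.List.Membership.Propositional.Properties
  using (∈-++⁺ˡ; ∈-++⁺ʳ; ∈-++⁻; ∈-∃++; ∈-lookup; ∈-map⁺; ∈-map⁻; ∈-filter⁺; ∈-filter⁻; ∈-allFin;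
         ∈-cartesianProduct⁺)
open import Data.List.Relation.Binary.Disjoint.Propositional using (Disjoint)
open import Data.List.Relation.Binary.Permutation.Propositional
  using (_↭_; prep; swap; ↭-sym; ↭-trans; ↭-refl; ↭⇒↭ₛ)
open import Data.List.Relation.Binary.Permutation.Propositional.Properties
  using (++⁺ʳ; ↭-reverse; shift; ↭-length; ∈-resp-↭)
import Data.List.Relation.Binary.Permutation.Setoid.Properties as Permₛ
open import Data.List.Relation.Unary.All as All using (All; []; _∷_)
import Data.List.Relation.Unary.All.Properties as Allₚ
open import Data.List.Relation.Unary.AllPairs using (AllPairs; []; _∷_)
open import Data.List.Relation.Unary.Any using (here; there)
open import Data.List.Relation.Unary.Linked using (Linked; [-]; _∷_)
import Data.List.Relation.Unary.Unique.DecPropositional as DecUnique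
open import Data.List.Relation.Unary.Unique.Propositional using (Unique)
open import Data.List.Relation.Unary.Unique.Propositional.Properties using (concat⁺)
open import Data.Nat as ℕ using (ℕ; zero; suc; z≤n; s≤s)
import Data.Nat.Properties as ℕₚ
open import Data.Product using (Σ; ∃; _×_; _,_; proj₁; proj₂)
open import Data.Sum using (_⊎_; inj₁; inj₂; [_,_]′) renaming (map to map-⊎; swap to swap-⊎)
open import Function using (_∘_)
open import Relation.Binary.Definitions using (tri<; tri≈; tri>)
open import Relation.Binary.PropositionalEquality
  using (_≡_; _≢_; refl; sym; trans; cong; cong₂; subst; subst₂; setoid; ≢-sym)
open import Relation.Nullary using (¬_; ¬?; Dec; yes; no)
open import Relation.Nullary.Decidable using (True; from-yes; toWitness; _⊎-dec_; _→-dec_)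

module Combinatorics where

  open import Data.Nat using (_+_; _*_; _≤_; _<_; _%_)
  open import Data.Nat.DivMod using (%-distribˡ-+; m%n<n; m<n⇒m%n≡m; [m+kn]%n≡m%n)
  open import Data.Nat.Properties
    using (+-assoc; +-comm; +-suc; +-cancelˡ-≡; +-mono-≤; +-monoʳ-≤; +-monoˡ-<; *-cancelʳ-<; *-cancelʳ-≡;
           *-monoˡ-≤; *-monoˡ-<; m≤m+n; m≤n+m; n≤1+n; ≤-refl; ≤-reflexive; ≤-trans; ≤-pred;
           <⇒≱; <-irrefl; module ≤-Reasoning)
  open Finₚ using (toℕ-fromℕ<; all?)

  -- Cycle lengths modulo 4.

  Admissible : ℕ → Set
  Admissible w = (w % 4 ≡ 2) ⊎ (w % 4 ≡ 3)

  admissible? : ∀ w → Dec (Admissible w)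
  admissible? w = (w % 4 ℕₚ.≟ 2) ⊎-dec (w % 4 ℕₚ.≟ 3)

  residue : ℕ → Fin 4
  residue m = fromℕ< (m%n<n m 4)

  residue-% : ∀ m → toℕ (residue m) % 4 ≡ m % 4
  residue-% m = trans (cong (_% 4) (toℕ-fromℕ< (m%n<n m 4))) (m<n⇒m%n≡m (m%n<n m 4))

  infix 4 _≡₄_
  -- A record, so that unification recovers `m` and `n` from the type; an equation of remainders
  -- alone would not determine them.
  record _≡₄_ (m n : ℕ) : Set where
    constructor mod₄
    field eq : m % 4 ≡ n % 4

  +-cong₄ : ∀ {a b c d} → a ≡₄ b → c ≡₄ d → a + c ≡₄ b + d
  +-cong₄ {a} {b} {c} {d} (mod₄ p) (mod₄ q) = mod₄ (trans (%-distribˡ-+ a c 4)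
    (trans (cong (_% 4) (cong₂ _+_ p q)) (sym (%-distribˡ-+ b d 4))))

  admissible-resp : ∀ {m n} → m ≡₄ n → Admissible m → Admissible n
  admissible-resp (mod₄ p) = [ inj₁ ∘ trans (sym p) , inj₂ ∘ trans (sym p) ]′

  -- The residues belong to the six edges of K₄, with opposite pairs `a`, `e`; `b`, `d`; `c`, `f`.
  -- The sums of three are the triangles, the sums of four the quadrangles. Instead of the counting
  -- argument, all residues are searched; each hypothesis follows directly on the last variable it
  -- mentions, so that a failing branch is cut off early.
  K₄-residues : (a b c : Fin 4) → Admissible (toℕ a + (toℕ b + toℕ c)) →
                (d e : Fin 4) → Admissible (toℕ c + (toℕ e + toℕ d)) →
                Admissible (toℕ a + (toℕ b + (toℕ e + toℕ d))) →
                (f : Fin 4) → Admissible (toℕ a + (toℕ d + toℕ f)) →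
                Admissible (toℕ b + (toℕ e + toℕ f)) →
                Admissible (toℕ a + (toℕ c + (toℕ e + toℕ f))) →
                Admissible (toℕ b + (toℕ c + (toℕ d + toℕ f))) → ⊥
  K₄-residues = from-yes
    (all? λ (a : Fin 4) → all? λ (b : Fin 4) → all? λ (c : Fin 4) → admissible? (toℕ a + (toℕ b + toℕ c)) →-dec
    (all? λ (d : Fin 4) → all? λ (e : Fin 4) → admissible? (toℕ c + (toℕ e + toℕ d)) →-dec
    (admissible? (toℕ a + (toℕ b + (toℕ e + toℕ d))) →-dec
    (all? λ (f : Fin 4) → admissible? (toℕ a + (toℕ d + toℕ f)) →-dec
    (admissible? (toℕ b + (toℕ e + toℕ f)) →-dec
    (admissible? (toℕ a + (toℕ c + (toℕ e + toℕ f))) →-dec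
    ¬? (admissible? (toℕ b + (toℕ c + (toℕ d + toℕ f))))))))))

  K₄-inadmissible : (a b c d e f : ℕ) →
    Admissible (a + (b + c)) → Admissible (c + (e + d)) → Admissible (a + (b + (e + d))) →
    Admissible (a + (d + f)) → Admissible (b + (e + f)) →
    Admissible (a + (c + (e + f))) → Admissible (b + (c + (d + f))) → ⊥
  K₄-inadmissible a b c d e f p₁ p₂ p₃ p₄ p₅ p₆ p₇ =
    K₄-residues (residue a) (residue b) (residue c) (sum₃ a b c p₁)
      (residue d) (residue e) (sum₃ c e d p₂) (sum₄ a b e d p₃)
      (residue f) (sum₃ a d f p₄) (sum₃ b e f p₅) (sum₄ a c e f p₆) (sum₄ b c d f p₇)
    where
    r : ∀ m → m ≡₄ toℕ (residue m)
    r m = mod₄ (sym (residue-% m))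
    sum₃ : ∀ x y z → Admissible (x + (y + z)) →
            Admissible (toℕ (residue x) + (toℕ (residue y) + toℕ (residue z)))
    sum₃ x y z = admissible-resp (+-cong₄ (r x) (+-cong₄ (r y) (r z)))
    sum₄ : ∀ x y z t → Admissible (x + (y + (z + t))) →
           Admissible (toℕ (residue x) + (toℕ (residue y) + (toℕ (residue z) + toℕ (residue t))))
    sum₄ x y z t = admissible-resp (+-cong₄ (r x) (+-cong₄ (r y) (+-cong₄ (r z) (r t))))

  -- Lists without repetition and weighted paths.

  module _ {V : Set} where

    Unique-resp-↭ : {xs ys : List V} → xs ↭ ys → Unique xs → Unique ys
    Unique-resp-↭ p = Permₛ.Unique-resp-↭ (setoid V) (↭⇒↭ₛ p)

    Unique-++⁻ : (xs : List V) {ys : List V} → Unique (xs ++ ys) → Unique xs × Unique ys × Disjoint xs ys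
    Unique-++⁻ [] u = [] , u , λ ()
    Unique-++⁻ (x ∷ xs) (x≢ ∷ u) with Unique-++⁻ xs u
    ... | uxs , uys , dis = (Allₚ.++⁻ˡ xs x≢ ∷ uxs) , uys , λ where
      (here refl , q) → All.lookup (Allₚ.++⁻ʳ xs x≢) q refl
      (there p , q) → dis (p , q)

    Unique-concat⁻ : (xss : List (List V)) → Unique (concat xss) → All Unique xss × AllPairs Disjoint xss
    Unique-concat⁻ [] u = [] , []
    Unique-concat⁻ (xs ∷ xss) u with Unique-++⁻ xs u
    ... | uxs , urest , dis with Unique-concat⁻ xss urest
    ... | us , ds = (uxs ∷ us) , (disjoint-all xss (λ p q → dis (p , q)) ∷ ds)
      where
      disjoint-all : ∀ yss → (∀ {v} → v ∈ xs → v ∉ concat yss) → All (Disjoint xs) yss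
      disjoint-all [] _ = []
      disjoint-all (ys ∷ yss) f =
        (λ (p , q) → f p (∈-++⁺ˡ q)) ∷ disjoint-all yss (λ p q → f p (∈-++⁺ʳ ys q))

    lookup-disjoint : {xss : List (List V)} → AllPairs Disjoint xss →
                      ∀ i j → i ≢ j → Disjoint (lookup xss i) (lookup xss j)
    lookup-disjoint (_ ∷ _) zero zero i≢j = ⊥-elim (i≢j refl)
    lookup-disjoint {_ ∷ xss} (d ∷ _) zero (suc j) _ = All.lookup d (∈-lookup j)
    lookup-disjoint {_ ∷ xss} (d ∷ _) (suc i) zero _ (p , q) = All.lookup d (∈-lookup i) (q , p)
    lookup-disjoint (_ ∷ ds) (suc i) (suc j) i≢j = lookup-disjoint ds i j (i≢j ∘ cong suc)

    -- Reduces distinctness of the vertices on each of the seven cycles of a subdivided K₄ to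
    -- distinctness of a short list of block indices, which is decided by computation.
    Unique-select : (xss : List (List V)) → Unique (concat xss) →
                    (is : List (Fin (length xss))) → Unique is → Unique (concat (map (lookup xss) is))
    Unique-select xss u is uis with Unique-concat⁻ xss u
    ... | us , ds = concat⁺ (uniques is) (disjoints uis)
      where
      uniques : ∀ is → All Unique (map (lookup xss) is)
      uniques [] = []
      uniques (i ∷ is) = All.lookup us (∈-lookup i) ∷ uniques is
      disjoints : ∀ {is} → Unique is → AllPairs Disjoint (map (lookup xss) is)
      disjoints [] = []
      disjoints (i≢ ∷ uis) = Allₚ.map⁺ (All.map (lookup-disjoint ds _ _) i≢) ∷ disjoints uis

    -- The list of a path holds its interior vertices only.
    data Path (R : V → V → ℕ → Set) : V → V → List V → ℕ → Set where
      [_] : ∀ {u v w} → R u v w → Path R u v [] w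
      _∷_ : ∀ {u x v is w m} → R u x w → Path R x v is m → Path R u v (x ∷ is) (w + m)

    -- Since links are symmetric, going back and forth along one edge is also a closed path; the
    -- bound on `length is` excludes it. Pairs of parallel edges are thereby exempt too.
    CyclesAdmissible : (V → V → ℕ → Set) → Set
    CyclesAdmissible R = ∀ {u is w} → Path R u u is w → Unique (u ∷ is) → 2 ≤ length is → Admissible w

    mapPath : ∀ {R S : V → V → ℕ → Set} → (∀ {u v w} → R u v w → S u v w) →
              ∀ {u v is w} → Path R u v is w → Path S u v is w
    mapPath f [ e ] = [ f e ]
    mapPath f (e ∷ p) = f e ∷ mapPath f p

    CyclesAdmissible-⊆ : ∀ {R S : V → V → ℕ → Set} → (∀ {u v w} → R u v w → S u v w) →
                         CyclesAdmissible S → CyclesAdmissible R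
    CyclesAdmissible-⊆ f good p = good (mapPath f p)

    module _ {R : V → V → ℕ → Set} where

      infixr 5 _⌢_
      _⌢_ : ∀ {u v z is js m k} → Path R u v is m → Path R v z js k → Path R u z (is ++ v ∷ js) (m + k)
      [ e ] ⌢ q = e ∷ q
      _⌢_ {k = k} (_∷_ {w = w} {m = m} e p) q = subst (Path R _ _ _) (sym (+-assoc w m k)) (e ∷ (p ⌢ q))

    -- Exclusion of subdivided K₄.

    module _ {R : V → V → ℕ → Set} (R-sym : ∀ {u v w} → R u v w → R v u w) where

      reversePath : ∀ {u v is w} → Path R u v is w → Path R v u (reverse is) w
      reversePath [ e ] = [ R-sym e ]
      reversePath {u} {v} (_∷_ {x = x} {is = is} {w = w} {m = m} e p) =
        subst (λ js → Path R v u js (w + m)) (sym (unfold-reverse x is))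
          (subst (Path R v u _) (+-comm m w) (reversePath p ⌢ [ R-sym e ]))

      private
        unique? = DecUnique.unique? (Finₚ._≟_ {7})

      -- The branch vertices are `h`, `g`, `c`, `d`. The edges h-g, c-d and d-g are subdivided, with
      -- interiors `A`, `B` and `I`; the other three are single links. This is the shape that arises
      -- from a path with chords.
      noK₄ : CyclesAdmissible R → ∀ {h g c d A B I wa wb wc wd we wf} →
             Path R h g A wa → R g c wb → R h c wc → R h d wd → Path R c d B we → Path R d g I wf →
             Unique (h ∷ A ++ g ∷ c ∷ B ++ d ∷ I) → ⊥
      noK₄ good {h} {g} {c} {d} {A} {B} {I} {wa} {wb} {wc} {wd} {we} {wf} p gc hc hd q r u =
        K₄-inadmissible wa wb wc wd we wf
          (good (p ⌢ [ gc ] ⌢ [ R-sym hc ]) (select u (# 0 ∷ # 1 ∷ # 2 ∷ # 3 ∷ [])) (2≤ A))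
          (good ([ hc ] ⌢ q ⌢ [ R-sym hd ]) (select u (# 0 ∷ # 3 ∷ # 4 ∷ # 5 ∷ [])) (s≤s (1≤ B)))
          (good (p ⌢ [ gc ] ⌢ q ⌢ [ R-sym hd ])
                (select u (# 0 ∷ # 1 ∷ # 2 ∷ # 3 ∷ # 4 ∷ # 5 ∷ [])) (2≤ A))
          (good (p̄ ⌢ [ hd ] ⌢ r)
                (tidy (λ J → g ∷ reverse A ++ h ∷ d ∷ J)
                      (select ū (# 2 ∷ # 1 ∷ # 0 ∷ # 5 ∷ # 6 ∷ []))) (2≤ (reverse A)))
          (good ([ gc ] ⌢ q ⌢ r)
                (tidy (λ J → g ∷ c ∷ B ++ d ∷ J)
                      (select u (# 2 ∷ # 3 ∷ # 4 ∷ # 5 ∷ # 6 ∷ []))) (s≤s (1≤ B)))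
          (good (p̄ ⌢ [ hc ] ⌢ q ⌢ r)
                (tidy (λ J → g ∷ reverse A ++ h ∷ c ∷ B ++ d ∷ J)
                      (select ū (# 2 ∷ # 1 ∷ # 0 ∷ # 3 ∷ # 4 ∷ # 5 ∷ # 6 ∷ []))) (2≤ (reverse A)))
          (good ([ gc ] ⌢ [ R-sym hc ] ⌢ [ hd ] ⌢ r)
                (tidy (λ J → g ∷ c ∷ h ∷ d ∷ J)
                      (select u (# 2 ∷ # 3 ∷ # 0 ∷ # 5 ∷ # 6 ∷ []))) (s≤s (s≤s z≤n)))
        where
        p̄ = reversePath p
        -- Two of the cycles start at `g` and run through `A` backwards.
        ū : Unique (h ∷ reverse A ++ g ∷ c ∷ B ++ d ∷ I)
        ū = Unique-resp-↭ (prep h (++⁺ʳ _ (↭-sym (↭-reverse A)))) u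
        tidy : (f : List V → List V) → Unique (f (I ++ [])) → Unique (f I)
        tidy f = subst (Unique ∘ f) (++-identityʳ I)
        -- The indices 0 to 6 stand for the blocks `h`, `A`, `g`, `c`, `B`, `d`, `I`.
        select : ∀ {A} → Unique (h ∷ A ++ g ∷ c ∷ B ++ d ∷ I) →
                 (is : List (Fin 7)) {_ : True (unique? is)} → Unique _
        select {A} v is {t} = Unique-select ((h ∷ []) ∷ A ∷ (g ∷ []) ∷ (c ∷ []) ∷ B ∷ (d ∷ []) ∷ I ∷ [])
          (subst (λ J → Unique (h ∷ A ++ g ∷ c ∷ B ++ d ∷ J)) (sym (++-identityʳ I)) v) is (toWitness t)
        1≤ : ∀ xs {y ys} → 1 ≤ length (xs ++ y ∷ ys)
        1≤ [] = s≤s z≤n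
        1≤ (_ ∷ xs) = s≤s z≤n
        2≤ : ∀ xs {y z zs} → 2 ≤ length (xs ++ y ∷ z ∷ zs)
        2≤ [] = s≤s (s≤s z≤n)
        2≤ (_ ∷ xs) = s≤s (1≤ xs)

  -- Cycles under suppression of a vertex of degree two.

  module _ {V : Set} {R S New : V → V → ℕ → Set} (v : V)
    (split   : ∀ {x y w} → S x y w → R x y w ⊎ New x y w)
    (avoid   : ∀ {x y w} → S x y w → x ≢ v)
    (through : ∀ {x y w} → New x y w → Path R x y (v ∷ []) w)
    (New-sym : ∀ {x y w} → New x y w → New y x w)
    (single  : ∀ {x y w x′ y′ w′} → New x y w → New x′ y′ w′ → (x ≡ x′) ⊎ (x ≡ y′))
    where

    -- By `single` every new link has `x` as one of its ends, so a path that misses `x` consists of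
    -- old links.
    lift-unused : ∀ {x y w p q is m} → New x y w → Path S p q is m → All (x ≢_) (p ∷ is) → x ≢ q →
                  Path R p q is m
    lift-unused e [ s ] (x≢p ∷ []) x≢q with split s
    ... | inj₁ r = [ r ]
    ... | inj₂ e′ = ⊥-elim ([ x≢p , x≢q ]′ (single e e′))
    lift-unused e (s ∷ t) (x≢p ∷ x≢) x≢q with split s
    ... | inj₁ r = r ∷ lift-unused e t x≢ x≢q
    ... | inj₂ e′ = ⊥-elim ([ x≢p , All.head x≢ ]′ (single e e′))

    lift-path : ∀ {x z is m} → Path S x z is m → Unique (x ∷ is) → All (z ≢_) (x ∷ is) →
                ∃ λ js → Path R x z js m × ((js ↭ is) ⊎ (js ↭ v ∷ is))
    lift-path [ s ] u z≢ with split s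
    ... | inj₁ r = _ , [ r ] , inj₁ ↭-refl
    ... | inj₂ e = _ , through e , inj₂ ↭-refl
    lift-path (_∷_ {x = y} s t) (x≢ ∷ u) (z≢x ∷ z≢) with split s
    ... | inj₂ e = _ , through e ⌢ lift-unused e t x≢ (≢-sym z≢x) , inj₂ ↭-refl
    ... | inj₁ r with lift-path t u z≢
    ...   | js , t′ , inj₁ p = _ , r ∷ t′ , inj₁ (prep y p)
    ...   | js , t′ , inj₂ p = _ , r ∷ t′ , inj₂ (↭-trans (prep y p) (swap y v ↭-refl))

    avoid-interior : ∀ {x z is m} → Path S x z is m → All (v ≢_) (x ∷ is)
    avoid-interior [ s ] = ≢-sym (avoid s) ∷ []
    avoid-interior (s ∷ t) = ≢-sym (avoid s) ∷ avoid-interior t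

    -- The ends of a cycle coincide, which `lift-path` forbids, so the first link is treated apart.
    -- If it is old, the remaining path is lifted. If it is new, the second link is old because
    -- neither of its ends is `u`, and all later ones are old because they miss `y`. The lifted
    -- cycle has the same weight and still at least three vertices.
    CyclesAdmissible-subdivide : CyclesAdmissible R → CyclesAdmissible S
    CyclesAdmissible-subdivide good [ _ ] u ()
    CyclesAdmissible-subdivide good (_ ∷ [ _ ]) u (s≤s ())
    CyclesAdmissible-subdivide good {u} (_∷_ {x = y} s p@(s′ ∷ t)) ((u≢y ∷ u≢z ∷ u≢) ∷ q@((y≢z ∷ y≢) ∷ _)) len
      with split s | avoid-interior (s ∷ p)
    ... | inj₁ r | v≢u ∷ v≢ with lift-path p q (u≢y ∷ u≢z ∷ u≢)
    ...   | js , p′ , inj₁ js↭ = good (r ∷ p′)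
              (Unique-resp-↭ (prep u (prep y (↭-sym js↭))) ((u≢y ∷ u≢z ∷ u≢) ∷ q))
              (s≤s (≤-trans (s≤s z≤n) (≤-reflexive (sym (↭-length js↭)))))
    ...   | js , p′ , inj₂ js↭ = good (r ∷ p′)
              (Unique-resp-↭ (↭-sym (↭-trans (prep u (↭-trans (prep y js↭) (swap y v ↭-refl))) (swap u v ↭-refl)))
                ((v≢u ∷ v≢) ∷ (u≢y ∷ u≢z ∷ u≢) ∷ q))
              (s≤s (≤-trans (s≤s z≤n) (≤-reflexive (sym (↭-length js↭)))))
    CyclesAdmissible-subdivide good {u} (_∷_ {x = y} s p@(s′ ∷ t)) ((u≢y ∷ u≢z ∷ u≢) ∷ q@((y≢z ∷ y≢) ∷ _)) len
        | inj₂ e | v≢u ∷ v≢ with split s′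
    ... | inj₂ e′ = ⊥-elim ([ u≢y , u≢z ]′ (single e e′))
    ... | inj₁ r′ = good (through e ⌢ (r′ ∷ lift-unused (New-sym e) t (y≢z ∷ y≢) (≢-sym u≢y)))
              (Unique-resp-↭ (swap v u ↭-refl) ((v≢u ∷ v≢) ∷ (u≢y ∷ u≢z ∷ u≢) ∷ q))
              (s≤s (s≤s z≤n))

  lookup-injective : ∀ {A : Set} {xs : List A} → Unique xs → ∀ {i j} → lookup xs i ≡ lookup xs j → i ≡ j
  lookup-injective (_ ∷ _) {zero} {zero} _ = refl
  lookup-injective (x≢ ∷ _) {zero} {suc j} eq = ⊥-elim (All.lookup x≢ (∈-lookup j) eq)
  lookup-injective (x≢ ∷ _) {suc i} {zero} eq = ⊥-elim (All.lookup x≢ (∈-lookup i) (sym eq))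
  lookup-injective (_ ∷ u) {suc i} {suc j} eq = cong suc (lookup-injective u eq)

  Unique⇒length≤ : ∀ {n} {xs : List (Fin n)} → Unique xs → length xs ≤ n
  Unique⇒length≤ u = Finₚ.injective⇒≤ (lookup-injective u)

  -- Here `T` is what follows the end `h` of a path and `P` is adjacency to `h`. The predecessor `g`
  -- of `c` becomes the new end after a rotation at `c`.
  record Split {V : Set} (P : V → Set) (T : List V) : Set where
    constructor splitting
    field
      {A B D} : List V
      {g c d} : V
      shape   : T ≡ A ++ g ∷ c ∷ B ++ d ∷ D
      Pc      : P c
      Pd      : P d

  -- Weighted multigraphs and their reductions.

  module _ {n : ℕ} where
    private V = Fin n

    -- A list, since suppressing vertices creates parallel edges. The number attached to an edge
    -- counts the edges of the original graph that it stands for.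
    Edges : Set
    Edges = List (V × V × ℕ)

    Link : Edges → V → V → ℕ → Set
    Link E u v w = ((u , v , w) ∈ E) ⊎ ((v , u , w) ∈ E)

    Link-sym : ∀ {E u v w} → Link E u v w → Link E v u w
    Link-sym = swap-⊎

    Isolated : Edges → V → Set
    Isolated E v = ∀ {z w} → ¬ Link E v z w

    Loopless : Edges → Set
    Loopless E = ∀ {v w} → ¬ ((v , v , w) ∈ E)

    Joins : V × V × ℕ → V → V → ℕ → Set
    Joins e u v w = (e ≡ (u , v , w)) ⊎ (e ≡ (v , u , w))

    joins⇒link : ∀ {E e u v w} → e ∈ E → Joins e u v w → Link E u v w
    joins⇒link p (inj₁ refl) = inj₁ p
    joins⇒link p (inj₂ refl) = inj₂ p

    -- In `series` the condition `a ≢ b` prevents the merged edge from being a loop; with equal far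
    -- ends the two edges fall under `parallel`, which leaves the degree of `v` free.
    data Reduction (E : Edges) : Set where
      pendant  : ∀ {v z w e O} → E ↭ e ∷ O → Joins e v z w → Isolated O v → Reduction E
      parallel : ∀ {v z w w′ e e′ O} → E ↭ e ∷ e′ ∷ O → Joins e v z w → Joins e′ v z w′ → Reduction E
      series   : ∀ {v a b w w′ e e′ O} → E ↭ e ∷ e′ ∷ O → Joins e v a w → Joins e′ v b w′ →
                 a ≢ b → Isolated O v → Reduction E

    record Spoke (v : V) (e : V × V × ℕ) : Set where
      constructor spoke
      field
        {end}    : V
        {weight} : ℕ
        joins    : Joins e v end weight

    record Star (v : V) (E : Edges) : Set where
      constructor star
      field
        {spokes others} : Edges
        perm            : E ↭ spokes ++ others
        touching        : All (Spoke v) spokes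
        avoiding        : Isolated others v

    starAt : ∀ v E → Star v E
    starAt v [] = star ↭-refl [] λ { (inj₁ ()) ; (inj₂ ()) }
    starAt v (e@(a , b , w) ∷ E) with starAt v E | v Finₚ.≟ a | v Finₚ.≟ b
    ... | star p t o | yes refl | _ = star (prep e p) (spoke (inj₁ refl) ∷ t) o
    ... | star p t o | no _ | yes refl = star (prep e p) (spoke (inj₂ refl) ∷ t) o
    ... | star {I} {O} p t o | no v≢a | no v≢b =
      star (↭-trans (prep e p) (↭-sym (shift e I O))) t λ where
        (inj₁ (here refl)) → v≢a refl
        (inj₂ (here refl)) → v≢b refl
        (inj₁ (there q)) → o (inj₁ q)
        (inj₂ (there q)) → o (inj₂ q)

    record Three (P : V → Set) : Set where
      constructor three
      field
        {x y z} : V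
        x≢y     : x ≢ y
        x≢z     : x ≢ z
        y≢z     : y ≢ z
        Px      : P x
        Py      : P y
        Pz      : P z

    Adjacent : Edges → V → V → Set
    Adjacent E u v = ∃ (Link E u v)

    -- One edge at `v` is pendant, and two are parallel or in series. With more, inspecting three is
    -- enough: two of them are parallel, or their far ends are three different neighbours.
    reduce-at : ∀ E v → ∃ (Adjacent E v) → Reduction E ⊎ Three (Adjacent E v)
    reduce-at E v (z , w , l) with starAt v E
    ... | star p [] o = ⊥-elim (o (map-⊎ (∈-resp-↭ p) (∈-resp-↭ p) l))
    ... | star p (spoke j ∷ []) o = inj₁ (pendant p j o)
    ... | star p (spoke {a} j ∷ spoke {b} k ∷ []) o with a Finₚ.≟ b
    ...   | yes refl = inj₁ (parallel p j k)
    ...   | no a≢b = inj₁ (series p j k a≢b o)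
    reduce-at E v (z , w , l) | star p (spoke {a} j ∷ spoke {b} k ∷ spoke {c} i ∷ t) o
      with a Finₚ.≟ b | a Finₚ.≟ c | b Finₚ.≟ c
    ... | yes refl | _ | _ = inj₁ (parallel p j k)
    ... | no _ | yes refl | _ = inj₁ (parallel (↭-trans p (prep _ (swap _ _ ↭-refl))) j i)
    ... | no _ | no _ | yes refl =
      inj₁ (parallel (↭-trans p (↭-trans (swap _ _ ↭-refl) (prep _ (swap _ _ ↭-refl)))) k i)
    ... | no a≢b | no a≢c | no b≢c = inj₂ (three a≢b a≢c b≢c
      (_ , joins⇒link (∈-resp-↭ (↭-sym p) (here refl)) j)
      (_ , joins⇒link (∈-resp-↭ (↭-sym p) (there (here refl))) k)
      (_ , joins⇒link (∈-resp-↭ (↭-sym p) (there (there (here refl)))) i))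

    module _ {P : V → Set} where

      ∈-tail : ∀ {x y : V} {xs} → x ≢ y → x ∈ y ∷ xs → x ∈ xs
      ∈-tail x≢y (here eq) = ⊥-elim (x≢y eq)
      ∈-tail x≢y (there p) = p

      split-two : ∀ t T {x y} → x ≢ y → x ∈ T → y ∈ T → P x → P y → Split P (t ∷ T)
      split-two t (s ∷ T) {x} {y} x≢y x∈ y∈ Px Py with x Finₚ.≟ s | y Finₚ.≟ s
      ... | yes refl | _ with ∈-∃++ (∈-tail (≢-sym x≢y) y∈)
      ...   | B , D , refl = splitting {A = []} {B} refl Px Py
      split-two t (s ∷ T) x≢y x∈ y∈ Px Py | no _ | yes refl with ∈-∃++ (∈-tail x≢y x∈)
      ...   | B , D , refl = splitting {A = []} {B} refl Py Px
      split-two t (s ∷ T) x≢y x∈ y∈ Px Py | no x≢s | no y≢s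
        with split-two s T x≢y (∈-tail x≢s x∈) (∈-tail y≢s y∈) Px Py
      ... | splitting {A} {B} shape Pc Pd = splitting {A = t ∷ A} {B} (cong (t ∷_) shape) Pc Pd

      -- Three elements are asked for although only two are returned: the one met first may be the
      -- head of `T` and is given up, so that `c` has a predecessor inside `T`.
      split-three : ∀ T → Three (λ x → P x × x ∈ T) → Split P T
      split-three [] (three _ _ _ (_ , ()) _ _)
      split-three (t ∷ T) (three {x} {y} {z} x≢y x≢z y≢z (Px , x∈) (Py , y∈) (Pz , z∈))
        with x Finₚ.≟ t | y Finₚ.≟ t | z Finₚ.≟ t
      ... | yes refl | _ | _ = split-two t T y≢z (∈-tail (≢-sym x≢y) y∈) (∈-tail (≢-sym x≢z) z∈) Py Pz
      ... | no _ | yes refl | _ = split-two t T x≢z (∈-tail x≢y x∈) (∈-tail (≢-sym y≢z) z∈) Px Pz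
      ... | no _ | no _ | yes refl = split-two t T x≢y (∈-tail x≢z x∈) (∈-tail y≢z y∈) Px Py
      ... | no x≢t | no y≢t | no z≢t
        with split-three T (three x≢y x≢z y≢z (Px , ∈-tail x≢t x∈) (Py , ∈-tail y≢t y∈) (Pz , ∈-tail z≢t z∈))
      ... | splitting {A} {B} shape Pc Pd = splitting {A = t ∷ A} {B} (cong (t ∷_) shape) Pc Pd

    module _ {E : Edges} where

      linked⇒path : ∀ {u v X} A → Linked (Adjacent E) (u ∷ A ++ v ∷ X) →
                    (∃ λ w → Path (Link E) u v A w) × Linked (Adjacent E) (v ∷ X)
      linked⇒path [] ((w , l) ∷ ls) = (w , [ l ]) , ls
      linked⇒path (a ∷ A) ((w , l) ∷ ls) with linked⇒path A ls
      ... | (m , p) , ls′ = (w + m , l ∷ p) , ls′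

      path⇒linked : ∀ {u v A X w} → Path (Link E) u v A w → Linked (Adjacent E) (v ∷ X) →
                    Linked (Adjacent E) (u ∷ A ++ v ∷ X)
      path⇒linked [ l ] ls = (_ , l) ∷ ls
      path⇒linked (l ∷ p) ls = (_ , l) ∷ path⇒linked p ls

    -- Rotating and prolonging paths until a reduction appears.

    module _ {E : Edges} (loopless : Loopless E) (good : CyclesAdmissible (Link E)) where

      open DecMembership (Finₚ._≟_ {n}) using (_∈?_)

      -- The alternatives at the end `h` of a path: reduce, prolong the path by `z`, or find three
      -- neighbours on the path. Absence of loops puts the latter into `T`.
      probe : ∀ h T → ∃ (Adjacent E h) →
              Reduction E ⊎ (∃ λ z → z ∉ h ∷ T × Adjacent E z h) ⊎ Three (λ x → Adjacent E h x × x ∈ T)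
      probe h T a with reduce-at E h a
      ... | inj₁ r = inj₁ r
      ... | inj₂ (three {x} {y} {z} x≢y x≢z y≢z Px Py Pz) with x ∈? h ∷ T | y ∈? h ∷ T | z ∈? h ∷ T
      ...   | no x∉ | _ | _ = inj₂ (inj₁ (x , x∉ , _ , Link-sym {E} (proj₂ Px)))
      ...   | yes _ | no y∉ | _ = inj₂ (inj₁ (y , y∉ , _ , Link-sym {E} (proj₂ Py)))
      ...   | yes _ | yes _ | no z∉ = inj₂ (inj₁ (z , z∉ , _ , Link-sym {E} (proj₂ Pz)))
      ...   | yes x∈ | yes y∈ | yes z∈ =
        inj₂ (inj₂ (three x≢y x≢z y≢z (Px , tail Px x∈) (Py , tail Py y∈) (Pz , tail Pz z∈)))
        where
        tail : ∀ {x} → Adjacent E h x → x ∈ h ∷ T → x ∈ T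
        tail (_ , l) (here refl) = ⊥-elim ([ loopless , loopless ]′ l)
        tail _ (there p) = p

      -- In the subdivided K₄ the connection between `d` and `g` follows the path from `d` to `y`
      -- and returns by the chord; it is the chord alone if `y` is `d`. The remainder of the path
      -- beyond `y` is cut off.
      no-chord-beyond : ∀ {h g c d A B D y} → Linked (Adjacent E) (h ∷ A ++ g ∷ c ∷ B ++ d ∷ D) →
                        Unique (h ∷ A ++ g ∷ c ∷ B ++ d ∷ D) → Adjacent E h c → Adjacent E h d →
                        Adjacent E g y → y ∉ d ∷ D
      no-chord-beyond {h} {g} {c} {d} {A} {B} {D} ls u (_ , hc) (_ , hd) (_ , gy) y∈ with linked⇒path A ls
      ... | (_ , p) , (_ , gc) ∷ ls′ with linked⇒path B ls′ | y∈
      ...   | (_ , q) , ls″ | here refl =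
        noK₄ (Link-sym {E}) good p gc hc hd q [ Link-sym {E} gy ]
          (proj₁ (Unique-++⁻ (h ∷ A ++ g ∷ c ∷ B ++ d ∷ []) (subst Unique (cong (h ∷_) eq) u)))
        where
        eq : A ++ g ∷ c ∷ B ++ d ∷ D ≡ (A ++ g ∷ c ∷ B ++ d ∷ []) ++ D
        eq = sym (trans (++-assoc A _ D) (cong (λ X → A ++ g ∷ c ∷ X) (++-assoc B (d ∷ []) D)))
      ...   | (_ , q) , ls″ | there y∈D with ∈-∃++ y∈D
      ...     | F , G , refl with linked⇒path F ls″
      ...       | (_ , r) , _ =
        noK₄ (Link-sym {E}) good p gc hc hd q (r ⌢ [ Link-sym {E} gy ])
          (proj₁ (Unique-++⁻ (h ∷ A ++ g ∷ c ∷ B ++ d ∷ F ++ _ ∷ []) (subst Unique (cong (h ∷_) eq) u)))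
        where
        eq : A ++ g ∷ c ∷ B ++ d ∷ F ++ _ ∷ G ≡ (A ++ g ∷ c ∷ B ++ d ∷ F ++ _ ∷ []) ++ G
        eq = sym (trans (++-assoc A _ G) (cong (λ X → A ++ g ∷ c ∷ X)
               (trans (++-assoc B _ G) (cong (λ X → B ++ d ∷ X) (++-assoc F (_ ∷ []) G)))))

      -- T is an initial part of the path holding three neighbours of its end h; each rotation shortens it.
      rotate : ∀ m h T C → length T ≤ m → Linked (Adjacent E) (h ∷ T ++ C) → Unique (h ∷ T ++ C) →
               Three (λ x → Adjacent E h x × x ∈ T) →
               (∀ z L → length L ≡ suc (length (T ++ C)) → Linked (Adjacent E) (z ∷ L) → Unique (z ∷ L) →
                  Reduction E) →
               Reduction E
      rotate m h T C T≤m ls u t extend with split-three T t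
      rotate zero h T C T≤m ls u t extend | splitting {A} refl hc hd = ⊥-elim (absurd A T≤m)
        where
        absurd : ∀ A {x xs} → ¬ (length (A ++ x ∷ xs) ≤ 0)
        absurd [] ()
        absurd (_ ∷ _) ()
      rotate (suc m) h _ C T≤m ls u t extend | splitting {A} {B} {D} {g} {c} {d} refl hc hd = result
        where
        T′ C′ M L : List V
        -- The link h-c replaces g-c, and the rotated path reads `g`, `reverse A`, `h`, `c`, `B`,
        -- `d`, `D`, `C`. Neighbours of `g` on it come before `d` by `no-chord-beyond`. Compared
        -- with `T`, the vertex `h` takes the place of `g`, while `d` and `D` are lost.
        T′ = reverse A ++ h ∷ c ∷ B
        C′ = d ∷ D ++ C
        M  = reverse A ++ h ∷ c ∷ B ++ C′
        L  = (A ++ g ∷ c ∷ B ++ d ∷ D) ++ C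

        eq : L ≡ A ++ g ∷ c ∷ B ++ C′
        eq = trans (++-assoc A _ C) (cong (λ X → A ++ g ∷ c ∷ X) (++-assoc B (d ∷ D) C))

        M≡ : M ≡ T′ ++ C′
        M≡ = sym (++-assoc (reverse A) (h ∷ c ∷ B) C′)

        ls₁ : Linked (Adjacent E) (h ∷ A ++ g ∷ c ∷ B ++ C′)
        ls₁ = subst (Linked (Adjacent E) ∘ (h ∷_)) eq ls

        u₁ : Unique (h ∷ A ++ g ∷ c ∷ B ++ C′)
        u₁ = subst (Unique ∘ (h ∷_)) eq u

        perm : h ∷ A ++ g ∷ c ∷ B ++ C′ ↭ g ∷ M
        perm = ↭-trans (prep h (shift g A _)) (↭-trans (swap h g ↭-refl)
          (prep g (↭-sym (↭-trans (shift h (reverse A) _) (prep h (++⁺ʳ _ (↭-reverse A)))))))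

        ls₂ : Linked (Adjacent E) (g ∷ M)
        ls₂ with linked⇒path A ls₁
        ... | (_ , p) , (_ ∷ ls′) = path⇒linked (reversePath (Link-sym {E}) p) (hc ∷ ls′)

        u₂ : Unique (g ∷ M)
        u₂ = Unique-resp-↭ perm u₁

        lengths : suc (length L) ≡ suc (length M)
        lengths = trans (cong (suc ∘ length) eq) (↭-length perm)

        shorter : length T′ ≤ m
        shorter = ≤-pred (≤-trans (≤-trans
          (≤-reflexive (cong suc (trans (length-++ (reverse A)) (cong (_+ (2 + length B)) (length-reverse A)))))
          (≤-trans (≤-reflexive (sym (+-suc (length A) _)))
            (≤-trans (+-monoʳ-≤ (length A) (s≤s (s≤s (≤-trans (m≤m+n (suc (length B)) (length D))
                        (≤-reflexive (trans (sym (+-suc (length B) (length D))) (sym (length-++ B))))))))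
              (≤-reflexive (sym (length-++ A)))))) T≤m)

        near : ∀ {x} → Adjacent E g x × x ∈ M → Adjacent E g x × x ∈ T′
        near (a , x∈) with ∈-++⁻ T′ (subst (_ ∈_) M≡ x∈)
        ... | inj₁ q = a , q
        ... | inj₂ q = ⊥-elim (no-chord-beyond {A = A} {B} ls₁ u₁ hc hd a q)

        g-adjacent : ∃ (Adjacent E g)
        g-adjacent with linked⇒path A ls₁
        ... | _ , (a ∷ _) = c , a

        result : Reduction E
        result with probe g M g-adjacent
        ... | inj₁ r = r
        ... | inj₂ (inj₁ (z , z∉ , a)) =
          extend z (g ∷ M) (sym lengths) (a ∷ ls₂) (Allₚ.¬Any⇒All¬ (g ∷ M) z∉ ∷ u₂)
        ... | inj₂ (inj₂ (three x≢y x≢z y≢z Px Py Pz)) =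
          rotate m g T′ C′ shorter (subst (Linked (Adjacent E) ∘ (g ∷_)) M≡ ls₂)
            (subst (Unique ∘ (g ∷_)) M≡ u₂) (three x≢y x≢z y≢z (near Px) (near Py) (near Pz))
            -- Rotation preserves the number of vertices, so a path prolonged after further
            -- rotations also has one vertex more than the original one.
            λ z L eqL → extend z L (trans eqL (trans (cong (suc ∘ length) (sym M≡)) (sym lengths)))

      -- The number `k` bounds the prolongations still possible: a path with more than `n` distinct
      -- vertices cannot exist. `rotate` returns to this induction through its last argument.
      reduce-from : ∀ k h t T → n < k + suc (suc (length T)) → Linked (Adjacent E) (h ∷ t ∷ T) →
                    Unique (h ∷ t ∷ T) → Reduction E
      reduce-from zero h t T n< ls u = ⊥-elim (<⇒≱ n< (Unique⇒length≤ u))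
      reduce-from (suc k) h t T n< ls@(a ∷ _) u with probe h (t ∷ T) (t , a)
      ... | inj₁ r = r
      ... | inj₂ (inj₁ (z , z∉ , b)) =
        reduce-from k z h (t ∷ T) (subst (n <_) (sym (+-suc k _)) n<) (b ∷ ls) (Allₚ.¬Any⇒All¬ _ z∉ ∷ u)
      ... | inj₂ (inj₂ tr) = rotate (length (t ∷ T)) h (t ∷ T) [] (≤-reflexive refl)
        (subst (Linked (Adjacent E) ∘ (h ∷_)) (sym T≡) ls) (subst (Unique ∘ (h ∷_)) (sym T≡) u) tr λ where
          z (y ∷ L) eq ls′ u′ → reduce-from k z y L
            (subst (λ l → n < k + suc l) (trans (cong (suc ∘ length) (sym T≡)) (sym eq))
              (subst (n <_) (sym (+-suc k _)) n<)) ls′ u′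
        where
        T≡ : (t ∷ T) ++ [] ≡ t ∷ T
        T≡ = ++-identityʳ (t ∷ T)

    reduction : ∀ e E → Loopless (e ∷ E) → CyclesAdmissible (Link (e ∷ E)) → Reduction (e ∷ E)
    reduction (a , b , w) E loopless good =
      reduce-from loopless good n a b [] (≤-trans (n≤1+n _) (≤-reflexive (+-comm 2 n)))
        ((w , inj₁ (here refl)) ∷ [-])
        (((λ { refl → loopless (here refl) }) ∷ []) ∷ [] ∷ [])

  -- Weak visibility representations and the insertion of a bar.

  -- Refined coordinates consist of an old coordinate `x` and a last digit `i` in base `suc k`; the
  -- remainder recovers the digit.
  digit-injective : ∀ {k} i j x x′ → i < suc k → j < suc k → i + x * suc k ≡ j + x′ * suc k → i ≡ j × x ≡ x′
  digit-injective {k} i j x x′ i< j< eq =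
    i≡j , *-cancelʳ-≡ x x′ (suc k) (+-cancelˡ-≡ j _ _ (subst (λ h → h + _ ≡ _) i≡j eq))
    where
    i≡j : i ≡ j
    i≡j = trans (sym (trans ([m+kn]%n≡m%n i x (suc k)) (m<n⇒m%n≡m i<)))
         (trans (cong (_% suc k) eq) (trans ([m+kn]%n≡m%n j x′ (suc k)) (m<n⇒m%n≡m j<)))

  digit-≤ : ∀ {k} i j {x x′} → j < suc k → i + x * suc k ≤ j + x′ * suc k → x ≤ x′
  digit-≤ {k} i j {x} {x′} j< le = ≤-pred (*-cancelʳ-< (suc k) x (suc x′) (begin-strict
    x * suc k            ≤⟨ m≤n+m _ i ⟩
    i + x * suc k        ≤⟨ le ⟩
    j + x′ * suc k       <⟨ +-monoˡ-< (x′ * suc k) j< ⟩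
    suc k + x′ * suc k   ∎))
    where open ≤-Reasoning

  -- A weak visibility representation: vertex v is the horizontal bar [left v , right v] at height
  -- y v, and Drawn a b x is a vertical edge in column x from the bar of a up to the bar of b.
  record Layout (n : ℕ) : Set₁ where
    field
      y left right : Fin n → ℕ
      Drawn        : Fin n → Fin n → ℕ → Set
      y-injective  : ∀ {u v} → y u ≡ y v → u ≡ v
      upward       : ∀ {a b x} → Drawn a b x → y a < y b
      column       : ∀ {a b a′ b′ x} → Drawn a b x → Drawn a′ b′ x → a ≡ a′ × b ≡ b′
      left≤right   : ∀ v → left v ≤ right v
      foot         : ∀ {a b x} → Drawn a b x → left a ≤ x × x ≤ right a
      head         : ∀ {a b x} → Drawn a b x → left b ≤ x × x ≤ right b
      clear        : ∀ {a b x v} → Drawn a b x → y a < y v → y v < y b → ¬ (left v ≤ x × x ≤ right v)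

    Free : Fin n → Set
    Free v = ∀ {z x} → ¬ Drawn v z x × ¬ Drawn z v x

    Shown : Fin n → Fin n → Set
    Shown u v = ∃ λ x → Drawn u v x ⊎ Drawn v u x

    Shown-sym : ∀ {u v} → Shown u v → Shown v u
    Shown-sym (x , d) = x , swap-⊎ d

  module _ {n : ℕ} where

    empty-layout : Layout n
    empty-layout = record
      { y = toℕ ; left = λ _ → 0 ; right = λ _ → 0 ; Drawn = λ _ _ _ → ⊥
      ; y-injective = Finₚ.toℕ-injective ; upward = λ () ; column = λ ()
      ; left≤right = λ _ → z≤n ; foot = λ () ; head = λ () ; clear = λ () }

    -- Doubling heights and tripling columns makes room for v just above a and for two columns next to
    -- x₀: one for the edge a–v, the other for an edge from v to b in case some edge a–b uses column x₀.
    module Attach (L : Layout n) {a v : Fin n} (x₀ : ℕ) (a≢v : a ≢ v) (free : Layout.Free L v)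
                  (x₀-in : Layout.left L a ≤ x₀ × x₀ ≤ Layout.right L a) where
      open Layout L

      -- The indices after the vertex are its new height, left end and right end. Old bars reach to
      -- the last of the three columns into which their right end splits, so that both new columns
      -- lie over the bars concerned even if `x₀` is their right end.
      data Place : Fin n → ℕ → ℕ → ℕ → Set where
        new : Place v (1 + y a * 2) (1 + x₀ * 3) (2 + x₀ * 3)
        old : ∀ {w} → w ≢ v → Place w (y w * 2) (left w * 3) (2 + right w * 3)

      place : ∀ w → ∃ λ h → ∃ λ l → ∃ λ r → Place w h l r
      place w with w Finₚ.≟ v
      ... | yes refl = _ , _ , _ , new
      ... | no w≢v = _ , _ , _ , old w≢v

      -- The last ternary digit of the column, 0, 1 or 2, tells the three kinds apart. The column is
      -- given by an equation instead of an index, so that two edges in one column can be compared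
      -- by their digits.
      data Drawn′ : Fin n → Fin n → ℕ → Set where
        keep  : ∀ {p q x x′} → Drawn p q x → x′ ≡ 0 + x * 3 → Drawn′ p q x′
        lower : ∀ {x′} → x′ ≡ 1 + x₀ * 3 → Drawn′ a v x′
        upper : ∀ {b x′} → Drawn a b x₀ → x′ ≡ 2 + x₀ * 3 → Drawn′ v b x′

      height : Fin n → ℕ
      height w = proj₁ (place w)

      leftEnd rightEnd : Fin n → ℕ
      leftEnd w = proj₁ (proj₂ (place w))
      rightEnd w = proj₁ (proj₂ (proj₂ (place w)))

      private
        0<3 : 0 < 3
        0<3 = s≤s z≤n
        1<3 : 1 < 3
        1<3 = s≤s (s≤s z≤n)
        2<3 : 2 < 3
        2<3 = ≤-refl

        within : ∀ i {l r x} → i < 3 → l ≤ x × x ≤ r → l * 3 ≤ i + x * 3 × i + x * 3 ≤ 2 + r * 3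
        within i i<3 (l≤x , x≤r) =
          ≤-trans (*-monoˡ-≤ 3 l≤x) (m≤n+m _ i) , +-mono-≤ (≤-pred i<3) (*-monoˡ-≤ 3 x≤r)

        within⁻ : ∀ i {l r x} → i < 3 → l * 3 ≤ i + x * 3 × i + x * 3 ≤ 2 + r * 3 → l ≤ x × x ≤ r
        within⁻ i i<3 (p , q) = digit-≤ 0 i i<3 p , digit-≤ i 2 2<3 q

      height-injective : ∀ {p q} → height p ≡ height q → p ≡ q
      height-injective {p} {q} eq with place p | place q
      ... | _ , _ , _ , new | _ , _ , _ , new = refl
      ... | _ , _ , _ , new | _ , _ , _ , old _ with digit-injective {1} 1 0 (y a) (y q) ≤-refl (s≤s z≤n) eq
      ...   | () , _
      height-injective {p} {q} eq | _ , _ , _ , old _ | _ , _ , _ , new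
        with digit-injective {1} 0 1 (y p) (y a) (s≤s z≤n) ≤-refl eq
      ...   | () , _
      height-injective {p} {q} eq | _ , _ , _ , old _ | _ , _ , _ , old _ =
        y-injective (*-cancelʳ-≡ (y p) (y q) 2 eq)

      upward′ : ∀ {p q x} → Drawn′ p q x → height p < height q
      upward′ {p} {q} (keep d _) with place p | place q
      ... | _ , _ , _ , new | _ = ⊥-elim (proj₁ free d)
      ... | _ , _ , _ , old _ | _ , _ , _ , new = ⊥-elim (proj₂ free d)
      ... | _ , _ , _ , old _ | _ , _ , _ , old _ = *-monoˡ-< 2 (upward d)
      upward′ (lower _) with place a | place v
      ... | _ , _ , _ , new | _ = ⊥-elim (a≢v refl)
      ... | _ , _ , _ , old _ | _ , _ , _ , new = ≤-refl
      ... | _ , _ , _ , old _ | _ , _ , _ , old v≢v = ⊥-elim (v≢v refl)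
      upward′ (upper {b} d _) with place v | place b
      ... | _ , _ , _ , old v≢v | _ = ⊥-elim (v≢v refl)
      ... | _ , _ , _ , new | _ , _ , _ , new = ⊥-elim (proj₂ free d)
      ... | _ , _ , _ , new | _ , _ , _ , old _ = *-monoˡ-≤ 2 (upward d)

      column′ : ∀ {p q p′ q′ x} → Drawn′ p q x → Drawn′ p′ q′ x → p ≡ p′ × q ≡ q′
      column′ (keep {x = x} d e) (keep {x = x′} d′ e′)
        with digit-injective 0 0 x x′ 0<3 0<3 (trans (sym e) e′)
      ... | _ , refl = column d d′
      column′ (keep {x = x} d e) (lower e′) with digit-injective 0 1 x x₀ 0<3 1<3 (trans (sym e) e′)
      ... | () , _
      column′ (keep {x = x} d e) (upper d′ e′) with digit-injective 0 2 x x₀ 0<3 2<3 (trans (sym e) e′)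
      ... | () , _
      column′ (lower e) (keep {x = x} d e′) with digit-injective 1 0 x₀ x 1<3 0<3 (trans (sym e) e′)
      ... | () , _
      column′ (lower e) (lower e′) = refl , refl
      column′ (lower e) (upper d e′) with digit-injective 1 2 x₀ x₀ 1<3 2<3 (trans (sym e) e′)
      ... | () , _
      column′ (upper d e) (keep {x = x} d′ e′) with digit-injective 2 0 x₀ x 2<3 0<3 (trans (sym e) e′)
      ... | () , _
      column′ (upper d e) (lower e′) with digit-injective 2 1 x₀ x₀ 2<3 1<3 (trans (sym e) e′)
      ... | () , _
      column′ (upper d e) (upper d′ e′) = refl , proj₂ (column d d′)

      left≤right′ : ∀ w → leftEnd w ≤ rightEnd w
      left≤right′ w with place w
      ... | _ , _ , _ , new = n≤1+n _
      ... | _ , _ , _ , old _ = ≤-trans (*-monoˡ-≤ 3 (left≤right w)) (m≤n+m _ 2)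

      foot′ : ∀ {p q x} → Drawn′ p q x → leftEnd p ≤ x × x ≤ rightEnd p
      foot′ {p} (keep d refl) with place p
      ... | _ , _ , _ , new = ⊥-elim (proj₁ free d)
      ... | _ , _ , _ , old _ = within 0 0<3 (foot d)
      foot′ (lower refl) with place a
      ... | _ , _ , _ , new = ⊥-elim (a≢v refl)
      ... | _ , _ , _ , old _ = within 1 1<3 x₀-in
      foot′ (upper d refl) with place v
      ... | _ , _ , _ , new = n≤1+n _ , ≤-refl
      ... | _ , _ , _ , old v≢v = ⊥-elim (v≢v refl)

      head′ : ∀ {p q x} → Drawn′ p q x → leftEnd q ≤ x × x ≤ rightEnd q
      head′ {q = q} (keep d refl) with place q
      ... | _ , _ , _ , new = ⊥-elim (proj₂ free d)
      ... | _ , _ , _ , old _ = within 0 0<3 (head d)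
      head′ (lower refl) with place v
      ... | _ , _ , _ , new = ≤-refl , n≤1+n _
      ... | _ , _ , _ , old v≢v = ⊥-elim (v≢v refl)
      head′ (upper {b} d refl) with place b
      ... | _ , _ , _ , new = ⊥-elim (proj₂ free d)
      ... | _ , _ , _ , old _ = within 2 2<3 (head d)

      -- The new bar covers only columns with digits 1 and 2, whereas kept edges have digit 0. No
      -- height lies strictly between those of `a` and `v`. An `upper` edge runs beside the old edge
      -- from `a` to `b`, and what would block it would have blocked that edge.
      clear′ : ∀ {p q x w} → Drawn′ p q x → height p < height w → height w < height q →
               ¬ (leftEnd w ≤ x × x ≤ rightEnd w)
      clear′ {p} {q} {w = w} (keep {x = x} d refl) p<w w<q inside with place p | place q | place w
      ... | _ , _ , _ , new | _ | _ = proj₁ free d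
      ... | _ , _ , _ , old _ | _ , _ , _ , new | _ = proj₂ free d
      ... | _ , _ , _ , old _ | _ , _ , _ , old _ | _ , _ , _ , new =
        <⇒≱ (*-cancelʳ-< 3 x₀ x (proj₁ inside)) (digit-≤ 0 2 2<3 (proj₂ inside))
      ... | _ , _ , _ , old _ | _ , _ , _ , old _ | _ , _ , _ , old _ =
        clear d (*-cancelʳ-< 2 (y p) (y w) p<w) (*-cancelʳ-< 2 (y w) (y q) w<q) (within⁻ 0 0<3 inside)
      clear′ (lower _) a<w w<v inside with place a | place v
      ... | _ , _ , _ , new | _ = a≢v refl
      ... | _ , _ , _ , old _ | _ , _ , _ , new = <⇒≱ a<w (≤-pred w<v)
      ... | _ , _ , _ , old _ | _ , _ , _ , old v≢v = v≢v refl
      clear′ {w = w} (upper {b} d refl) v<w w<b inside with place v | place b | place w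
      ... | _ , _ , _ , old v≢v | _ | _ = v≢v refl
      ... | _ , _ , _ , new | _ , _ , _ , new | _ = proj₂ free d
      ... | _ , _ , _ , new | _ , _ , _ , old _ | _ , _ , _ , new = <-irrefl refl v<w
      ... | _ , _ , _ , new | _ , _ , _ , old _ | _ , _ , _ , old _ =
        clear d (*-cancelʳ-< 2 (y a) (y w) (≤-trans (n≤1+n _) v<w)) (*-cancelʳ-< 2 (y w) (y b) w<b)
          (within⁻ 2 2<3 inside)

      attach : Layout n
      attach = record
        { y = height ; left = leftEnd ; right = rightEnd ; Drawn = Drawn′
        ; y-injective = λ {p} {q} → height-injective {p} {q} ; upward = upward′ ; column = column′
        ; left≤right = left≤right′ ; foot = foot′ ; head = head′ ; clear = λ {_} {_} {_} {w} → clear′ {w = w} }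

    -- Rebuilding the representation against the order of the reductions.

    open Attach using (attach; keep; lower; upper)

    -- Surplus segments are permitted: an edge split again by `represents-series` stays drawn. By
    -- `free`, a vertex without edges has no segment, so its bar can be moved when the vertex is
    -- attached.
    record Represents (E : Edges {n}) : Set₁ where
      field
        layout : Layout n
      open Layout layout public
      field
        shown : ∀ {u v w} → (u , v , w) ∈ E → Shown u v
        free  : ∀ {v} → Isolated E v → Free v

    Link-resp-↭ : ∀ {E F : Edges {n}} {u v w} → E ↭ F → Link E u v w → Link F u v w
    Link-resp-↭ p = map-⊎ (∈-resp-↭ p) (∈-resp-↭ p)

    Link-there : ∀ {E : Edges {n}} {e u v w} → Link E u v w → Link (e ∷ E) u v w
    Link-there = map-⊎ there there

    joins-transfer : ∀ {e : Fin n × Fin n × ℕ} {u v w p q t} {S : Fin n → Fin n → Set} →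
                     (∀ {x z} → S x z → S z x) → Joins e u v w → S u v → (p , q , t) ≡ e → S p q
    joins-transfer S-sym (inj₁ refl) s refl = s
    joins-transfer S-sym (inj₂ refl) s refl = S-sym s

    joins-distinct : ∀ {E : Edges {n}} {e u v w} → Loopless E → e ∈ E → Joins e u v w → u ≢ v
    joins-distinct loopless p (inj₁ refl) refl = loopless p
    joins-distinct loopless p (inj₂ refl) refl = loopless p

    represents-resp-↭ : ∀ {E F : Edges {n}} → E ↭ F → Represents E → Represents F
    represents-resp-↭ p rep = record
      { layout = layout ; shown = shown ∘ ∈-resp-↭ (↭-sym p)
      ; free = λ iso → free (λ l → iso (Link-resp-↭ p l)) }
      where open Represents rep

    module _ {E : Edges {n}} (rep : Represents E) where
      open Represents rep

      shown-joins : ∀ {e u v w} → e ∈ E → Joins e u v w → Shown u v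
      shown-joins p (inj₁ refl) = shown p
      shown-joins p (inj₂ refl) = Shown-sym (shown p)

      module _ {a v x₀} (a≢v : a ≢ v) (iso : Isolated E v) (x₀-in : left a ≤ x₀ × x₀ ≤ right a) where

        attached : Layout n
        attached = attach layout x₀ a≢v (free iso) x₀-in

        attached-shown : ∀ {p q} → Shown p q → Layout.Shown attached p q
        attached-shown (_ , d) = _ , map-⊎ (λ d → keep d refl) (λ d → keep d refl) d

        attached-free : ∀ {z} → Isolated E z → z ≢ a → z ≢ v → Layout.Free attached z
        attached-free iso-z z≢a z≢v =
          (λ { (keep d _) → proj₁ (free iso-z) d ; (lower _) → z≢a refl ; (upper _ _) → z≢v refl }) ,
          (λ { (keep d _) → proj₂ (free iso-z) d ; (lower _) → z≢v refl ; (upper d _) → proj₂ (free iso-z) d })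

    represents-pendant : ∀ {v z w e O} → Loopless (e ∷ O) → Joins e v z w → Isolated O v →
                         Represents O → Represents (e ∷ O)
    represents-pendant {v} {z} {w} {e} {O} loopless j iso rep = record
      { layout = A
      ; shown = λ where
          (here eq) → joins-transfer (Layout.Shown-sym A) j (_ , inj₂ (lower refl)) eq
          (there p) → attached-shown rep z≢v iso in₀ (shown p)
      ; free = λ i → attached-free rep z≢v iso in₀ (λ l → i (Link-there l))
          (λ { refl → i (Link-sym {E = e ∷ O} (joins⇒link (here refl) j)) })
          (λ { refl → i (joins⇒link (here refl) j) }) }
      where
      open Represents rep
      z≢v : z ≢ v
      z≢v = ≢-sym (joins-distinct loopless (here refl) j)
      -- Any column of the bar of `z` would serve.
      in₀ : left z ≤ left z × left z ≤ right z
      in₀ = ≤-refl , left≤right z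
      A = attached rep z≢v iso in₀

    -- `Shown` asks for some segment between the two bars, so one segment serves both edges.
    represents-parallel : ∀ {v z w w′ e e′ O} → Joins e v z w → Joins e′ v z w′ →
                          Represents (e ∷ O) → Represents (e ∷ e′ ∷ O)
    represents-parallel {O = O} j j′ rep = record
      { layout = layout
      ; shown = λ where
          (here eq) → shown (here eq)
          (there (here eq)) → joins-transfer Shown-sym j′ (shown-joins rep (here refl) j) eq
          (there (there p)) → shown (there p)
      ; free = λ i → free λ l → i (map-⊎ skip skip l) }
      where
      open Represents rep
      skip : ∀ {f e e′} → f ∈ e ∷ O → f ∈ e ∷ e′ ∷ O
      skip (here eq) = here eq
      skip (there p) = there (there p)

    -- The bar of `v` is put just above the lower end of the segment for a-b, in its column: `lower`
    -- joins `v` to that end and `upper` to the other one. The two clauses of `result` differ in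
    -- which of `a` and `b` is lower.
    represents-series : ∀ {v a b w w′ t e e′ O} → Loopless (e ∷ e′ ∷ O) → Joins e v a w → Joins e′ v b w′ →
                        Isolated O v → Represents ((a , b , t) ∷ O) → Represents (e ∷ e′ ∷ O)
    represents-series {v} {a} {b} {w} {w′} {t} {e} {e′} {O} loopless j j′ iso rep = result (shown (here refl))
      where
      open Represents rep
      F : Edges
      F = e ∷ e′ ∷ O
      a≢v : a ≢ v
      a≢v = ≢-sym (joins-distinct loopless (here refl) j)
      b≢v : b ≢ v
      b≢v = ≢-sym (joins-distinct loopless (there (here refl)) j′)
      iso′ : Isolated ((a , b , t) ∷ O) v
      iso′ (inj₁ (here refl)) = a≢v refl
      iso′ (inj₂ (here refl)) = b≢v refl
      iso′ (inj₁ (there p)) = iso (inj₁ p)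
      iso′ (inj₂ (there p)) = iso (inj₂ p)
      meets : ∀ {z} → Isolated F z → Isolated ((a , b , t) ∷ O) z × z ≢ a × z ≢ b × z ≢ v
      meets {z} i = iso-z , z≢a , z≢b , λ { refl → i (joins⇒link (here refl) j) }
        where
        z≢a : z ≢ a
        z≢a refl = i (Link-sym {E = F} (joins⇒link (here refl) j))
        z≢b : z ≢ b
        z≢b refl = i (Link-sym {E = F} (joins⇒link (there (here refl)) j′))
        iso-z : Isolated ((a , b , t) ∷ O) z
        iso-z (inj₁ (here refl)) = z≢a refl
        iso-z (inj₂ (here refl)) = z≢b refl
        iso-z (inj₁ (there p)) = i (inj₁ (there (there p)))
        iso-z (inj₂ (there p)) = i (inj₂ (there (there p)))
      result : Shown a b → Represents F
      result (x , inj₁ d) = record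
        { layout = A
        ; shown = λ where
            (here eq) → joins-transfer (Layout.Shown-sym A) j (_ , inj₂ (lower refl)) eq
            (there (here eq)) → joins-transfer (Layout.Shown-sym A) j′ (_ , inj₁ (upper d refl)) eq
            (there (there p)) → attached-shown rep a≢v iso′ (foot d) (shown (there p))
        ; free = λ i → let iso-z , z≢a , _ , z≢v = meets i in
          attached-free rep a≢v iso′ (foot d) iso-z z≢a z≢v }
        where A = attached rep a≢v iso′ (foot d)
      result (x , inj₂ d) = record
        { layout = A
        ; shown = λ where
            (here eq) → joins-transfer (Layout.Shown-sym A) j (_ , inj₁ (upper d refl)) eq
            (there (here eq)) → joins-transfer (Layout.Shown-sym A) j′ (_ , inj₂ (lower refl)) eq
            (there (there p)) → attached-shown rep b≢v iso′ (foot d) (shown (there p))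
        ; free = λ i → let iso-z , _ , z≢b , z≢v = meets i in
          attached-free rep b≢v iso′ (foot d) iso-z z≢b z≢v }
        where A = attached rep b≢v iso′ (foot d)

    joins-path : ∀ {E : Edges {n}} {e e′ v a b w w′} → e ∈ E → e′ ∈ E → Joins e v a w → Joins e′ v b w′ →
                 Path (Link E) a b (v ∷ []) (w + w′)
    joins-path {E} p p′ j j′ = Link-sym {E = E} (joins⇒link p j) ∷ [ joins⇒link p′ j′ ]

    admissible-series : ∀ {v a b w w′ e e′ O} → Loopless (e ∷ e′ ∷ O) → Joins e v a w → Joins e′ v b w′ →
                        Isolated O v → CyclesAdmissible (Link (e ∷ e′ ∷ O)) →
                        CyclesAdmissible (Link ((a , b , w + w′) ∷ O))
    admissible-series {v} {a} {b} {w} {w′} {e} {e′} {O} loopless j j′ iso =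
      CyclesAdmissible-subdivide {New = New} v split avoid through New-sym single
      where
      F : Edges
      F = e ∷ e′ ∷ O
      New : Fin n → Fin n → ℕ → Set
      New x y t = Joins (a , b , w + w′) x y t
      split : ∀ {x y t} → Link ((a , b , w + w′) ∷ O) x y t → Link F x y t ⊎ New x y t
      split (inj₁ (here refl)) = inj₂ (inj₁ refl)
      split (inj₂ (here refl)) = inj₂ (inj₂ refl)
      split (inj₁ (there p)) = inj₁ (inj₁ (there (there p)))
      split (inj₂ (there p)) = inj₁ (inj₂ (there (there p)))
      avoid : ∀ {x y t} → Link ((a , b , w + w′) ∷ O) x y t → x ≢ v
      avoid (inj₁ (here refl)) = ≢-sym (joins-distinct loopless (here refl) j)
      avoid (inj₂ (here refl)) = ≢-sym (joins-distinct loopless (there (here refl)) j′)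
      avoid (inj₁ (there p)) refl = iso (inj₁ p)
      avoid (inj₂ (there p)) refl = iso (inj₂ p)
      through : ∀ {x y t} → New x y t → Path (Link F) x y (v ∷ []) t
      through (inj₁ refl) = joins-path (here refl) (there (here refl)) j j′
      through (inj₂ refl) = subst (Path (Link F) b a (v ∷ [])) (+-comm w′ w)
        (joins-path (there (here refl)) (here refl) j′ j)
      New-sym : ∀ {x y t} → New x y t → New y x t
      New-sym = swap-⊎
      single : ∀ {x y t x′ y′ t′} → New x y t → New x′ y′ t′ → (x ≡ x′) ⊎ (x ≡ y′)
      single (inj₁ refl) (inj₁ refl) = inj₁ refl
      single (inj₁ refl) (inj₂ refl) = inj₂ refl
      single (inj₂ refl) (inj₁ refl) = inj₂ refl
      single (inj₂ refl) (inj₂ refl) = inj₁ refl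

    -- Each reduction lowers the number of edges by one: a series step removes two and adds one.
    represent : ∀ m (E : Edges {n}) → length E ≤ m → Loopless E → CyclesAdmissible (Link E) → Represents E
    represent m [] _ _ _ = record { layout = empty-layout ; shown = λ () ; free = λ _ → (λ ()) , (λ ()) }
    represent (suc m) E@(e₀ ∷ E₀) len loopless good with reduction e₀ E₀ loopless good
    ... | pendant {e = e} {O} p j iso = represents-resp-↭ (↭-sym p)
      (represents-pendant (loopless ∘ ∈-resp-↭ (↭-sym p)) j iso
        (represent m O (≤-pred (subst (_≤ suc m) (↭-length p) len)) (loopless ∘ ∈-resp-↭ (↭-sym p) ∘ there)
          (CyclesAdmissible-⊆ (Link-resp-↭ (↭-sym p) ∘ Link-there) good)))
    ... | parallel {e = e} {e′} {O} p j j′ = represents-resp-↭ (↭-sym p) (represents-parallel j j′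
        (represent m (e ∷ O) (≤-pred (subst (_≤ suc m) (↭-length p) len))
          (loopless ∘ ∈-resp-↭ (↭-sym p) ∘ skip)
          (CyclesAdmissible-⊆ (Link-resp-↭ (↭-sym p) ∘ map-⊎ skip skip) good)))
      where
      skip : ∀ {f} → f ∈ e ∷ O → f ∈ e ∷ e′ ∷ O
      skip (here eq) = here eq
      skip (there q) = there (there q)
    ... | series {a = a} {b} {w} {w′} {e} {e′} {O} p j j′ a≢b iso =
      represents-resp-↭ (↭-sym p) (represents-series loopless′ j j′ iso
        (represent m ((a , b , w + w′) ∷ O) (≤-pred (subst (_≤ suc m) (↭-length p) len))
          (λ { (here refl) → a≢b refl ; (there q) → loopless′ (there (there q)) })
          (admissible-series loopless′ j j′ iso (CyclesAdmissible-⊆ (Link-resp-↭ (↭-sym p)) good))))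
      where
      loopless′ : Loopless (e ∷ e′ ∷ O)
      loopless′ = loopless ∘ ∈-resp-↭ (↭-sym p)

open Combinatorics

-- Rational inequalities for linear interpolation.

module Drawings where

  open import Data.Rational using (ℚ; 0ℚ; 1ℚ; _+_; _*_; _-_; -_; _≤_; _<_; nonNegative; positive)
  import Data.Rational.Properties as ℚₚ
  open import Data.Rational.Solver using (module +-*-Solver)
  open +-*-Solver using (solve; con; _:+_; _:*_; _:-_; :-_; _:=_)

  lerp-lower : ∀ {a b t} → a ≤ b → 0ℚ ≤ t → a ≤ a + t * (b - a)
  lerp-lower {a} {b} {t} a≤b 0≤t = begin
    a                     ≡⟨ solve 2 (λ a t → a := (a :- t :* a) :+ t :* a) refl a t ⟩
    (a - t * a) + t * a   ≤⟨ ℚₚ.+-monoʳ-≤ (a - t * a) (ℚₚ.*-monoˡ-≤-nonNeg t {{nonNegative 0≤t}} a≤b) ⟩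
    (a - t * a) + t * b   ≡⟨ solve 3 (λ a b t → (a :- t :* a) :+ t :* b := a :+ t :* (b :- a)) refl a b t ⟩
    a + t * (b - a)       ∎
    where open ℚₚ.≤-Reasoning

  lerp-flip : ∀ a b t → a + t * (b - a) ≡ b + (1ℚ - t) * (a - b)
  lerp-flip = solve 3 (λ a b t → a :+ t :* (b :- a) := b :+ (con 1ℚ :- t) :* (a :- b)) refl

  complement-nonneg : ∀ {t} → t ≤ 1ℚ → 0ℚ ≤ 1ℚ - t
  complement-nonneg {t} t≤1 = subst (_≤ 1ℚ - t) (ℚₚ.+-inverseʳ t) (ℚₚ.+-monoˡ-≤ (- t) t≤1)

  complement-≤1 : ∀ {t} → 0ℚ ≤ t → 1ℚ - t ≤ 1ℚ
  complement-≤1 {t} 0≤t = subst (1ℚ - t ≤_) (ℚₚ.+-identityʳ 1ℚ) (ℚₚ.+-monoʳ-≤ 1ℚ (ℚₚ.neg-antimono-≤ 0≤t))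

  lerp-upper : ∀ {a b t} → a ≤ b → 0ℚ ≤ t → t ≤ 1ℚ → a + t * (b - a) ≤ b
  lerp-upper {a} {b} {t} a≤b 0≤t t≤1 = begin
    a + t * (b - a)             ≡⟨ solve 3 (λ a b t → a :+ t :* (b :- a)
                                      := (con 1ℚ :- t) :* a :+ t :* b) refl a b t ⟩
    (1ℚ - t) * a + t * b        ≤⟨ ℚₚ.+-monoˡ-≤ (t * b)
                                     (ℚₚ.*-monoˡ-≤-nonNeg (1ℚ - t) {{nonNegative (complement-nonneg t≤1)}} a≤b) ⟩
    (1ℚ - t) * b + t * b        ≡⟨ solve 2 (λ b t → (con 1ℚ :- t) :* b :+ t :* b := b) refl b t ⟩
    b                           ∎
    where open ℚₚ.≤-Reasoning

  lerp-strict : ∀ {a b c t} → b < c → 0ℚ < t → a + t * (b - a) < a + t * (c - a)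
  lerp-strict {a} {b} {c} {t} b<c 0<t =
    ℚₚ.+-monoʳ-< a (ℚₚ.*-monoʳ-<-pos t {{positive 0<t}} (ℚₚ.+-monoˡ-< (- a) b<c))

  -- Recursion lets `ι (suc k ℕ.* 3)` unfold to three added ones, as `gap` requires.
  ι : ℕ → ℚ
  ι zero = 0ℚ
  ι (suc n) = 1ℚ + ι n

  0<1 : 0ℚ < 1ℚ
  0<1 = ℚₚ.positive⁻¹ 1ℚ

  p<1+p : ∀ p → p < 1ℚ + p
  p<1+p p = subst (_< 1ℚ + p) (ℚₚ.+-identityˡ p) (ℚₚ.+-monoˡ-< p 0<1)

  ι-nonneg : ∀ n → 0ℚ ≤ ι n
  ι-nonneg zero = ℚₚ.≤-refl
  ι-nonneg (suc n) = ℚₚ.≤-trans (ι-nonneg n) (ℚₚ.<⇒≤ (p<1+p (ι n)))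

  ι-mono-≤ : ∀ {m n} → m ℕ.≤ n → ι m ≤ ι n
  ι-mono-≤ {n = n} z≤n = ι-nonneg n
  ι-mono-≤ (s≤s m≤n) = ℚₚ.+-monoʳ-≤ 1ℚ (ι-mono-≤ m≤n)

  ι-mono-< : ∀ {m n} → m ℕ.< n → ι m < ι n
  ι-mono-< m<n = ℚₚ.<-≤-trans (p<1+p _) (ι-mono-≤ m<n)

  ι-cancel-≤ : ∀ {m n} → ι m ≤ ι n → m ℕ.≤ n
  ι-cancel-≤ {m} {n} le with m ℕₚ.≤? n
  ... | yes m≤n = m≤n
  ... | no m≰n = ⊥-elim (ℚₚ.<-irrefl refl (ℚₚ.<-≤-trans (ι-mono-< (ℕₚ.≰⇒> m≰n)) le))

  ι-injective : ∀ {m n} → ι m ≡ ι n → m ≡ n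
  ι-injective eq = ℕₚ.≤-antisym (ι-cancel-≤ (ℚₚ.≤-reflexive eq)) (ι-cancel-≤ (ℚₚ.≤-reflexive (sym eq)))

  data Direction : Set where
    up down : Direction

  opposite : Direction → Direction
  opposite up = down
  opposite down = up

  sign : Direction → ℚ
  sign up = 1ℚ
  sign down = - 1ℚ

  sign-≤ : ∀ δ {t} → 0ℚ ≤ t → t ≤ 1ℚ → - 1ℚ ≤ t * sign δ × t * sign δ ≤ 1ℚ
  sign-≤ up {t} 0≤t t≤1 =
    subst (λ s → - 1ℚ ≤ s × s ≤ 1ℚ) (sym (ℚₚ.*-identityʳ t)) (ℚₚ.≤-trans (ℚₚ.nonPositive⁻¹ (- 1ℚ)) 0≤t , t≤1)
  sign-≤ down {t} 0≤t t≤1 =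
    subst (λ s → - 1ℚ ≤ s × s ≤ 1ℚ) (sym (solve 1 (λ t → t :* (:- con 1ℚ) := :- t) refl t))
      (ℚₚ.neg-antimono-≤ t≤1 , ℚₚ.≤-trans (ℚₚ.neg-antimono-≤ 0≤t) (ℚₚ.nonNegative⁻¹ 1ℚ))

  -- A sign is its own inverse, so the height of a point determines the parameter `t`.
  displacement : ∀ δ h t → ((h + t * sign δ) - h) * sign δ ≡ t
  displacement up = solve 2 (λ h t → ((h :+ t :* con 1ℚ) :- h) :* con 1ℚ := t) refl
  displacement down = solve 2 (λ h t → ((h :+ t :* (:- con 1ℚ)) :- h) :* (:- con 1ℚ) := t) refl

  up-down : ∀ {h t s} → 0ℚ ≤ t → 0ℚ ≤ s → h + t * 1ℚ ≡ h + s * (- 1ℚ) → t ≡ 0ℚ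
  up-down {h} {t} {s} 0≤t 0≤s eq = ℚₚ.≤-antisym (subst (_≤ 0ℚ) (sym t≡-s) (ℚₚ.neg-antimono-≤ 0≤s)) 0≤t
    where
    t≡-s : t ≡ - s
    t≡-s = trans (sym (displacement up h t)) (trans (cong (λ k → (k - h) * 1ℚ) eq)
      (solve 2 (λ h s → ((h :+ s :* (:- con 1ℚ)) :- h) :* con 1ℚ := :- s) refl h s))

  -1≤1 : - 1ℚ ≤ 1ℚ
  -1≤1 = ℚₚ.≤-trans (ℚₚ.nonPositive⁻¹ (- 1ℚ)) (ℚₚ.nonNegative⁻¹ 1ℚ)

  1≰0 : ¬ (1ℚ ≤ 0ℚ)
  1≰0 1≤0 = ℚₚ.<-irrefl refl (ℚₚ.<-≤-trans 0<1 1≤0)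

  reach-up : ∀ {h t} → h + 1ℚ ≤ h + t * 1ℚ → 1ℚ ≤ t
  reach-up {h} {t} le = subst₂ _≤_
    (solve 1 (λ h → :- h :+ (h :+ con 1ℚ) := con 1ℚ) refl h)
    (solve 2 (λ h t → :- h :+ (h :+ t :* con 1ℚ) := t) refl h t) (ℚₚ.+-monoʳ-≤ (- h) le)

  reach-down : ∀ {h t} → h + t * (- 1ℚ) ≤ h + - 1ℚ → 1ℚ ≤ t
  reach-down {h} {t} le = subst₂ _≤_
    (solve 1 (λ h → h :+ :- (h :+ (:- con 1ℚ)) := con 1ℚ) refl h)
    (solve 2 (λ h t → h :+ :- (h :+ t :* (:- con 1ℚ)) := t) refl h t) (ℚₚ.+-monoʳ-≤ h (ℚₚ.neg-antimono-≤ le))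

  no-reach-up : ∀ {h t} → 0ℚ ≤ t → ¬ (h + 1ℚ ≤ h + t * (- 1ℚ))
  no-reach-up {h} {t} 0≤t le = 1≰0 (ℚₚ.≤-trans (subst₂ _≤_
    (solve 1 (λ h → :- h :+ (h :+ con 1ℚ) := con 1ℚ) refl h)
    (solve 2 (λ h t → :- h :+ (h :+ t :* (:- con 1ℚ)) := :- t) refl h t) (ℚₚ.+-monoʳ-≤ (- h) le))
    (ℚₚ.neg-antimono-≤ 0≤t))

  no-reach-down : ∀ {h t} → 0ℚ ≤ t → ¬ (h + t * 1ℚ ≤ h + - 1ℚ)
  no-reach-down {h} {t} 0≤t le = 1≰0 (ℚₚ.≤-trans (subst₂ _≤_
    (solve 1 (λ h → h :+ :- (h :+ (:- con 1ℚ)) := con 1ℚ) refl h)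
    (solve 2 (λ h t → h :+ :- (h :+ t :* con 1ℚ) := :- t) refl h t) (ℚₚ.+-monoʳ-≤ h (ℚₚ.neg-antimono-≤ le)))
    (ℚₚ.neg-antimono-≤ 0≤t))

  -- Bent edges in the plane.

  module Geometry {n : ℕ} (L : Layout n) where
    open Layout L

    -- A vertex sits at the left end of its bar. The factor 3 makes the strips within distance one
    -- of different bars disjoint, and all bending happens in these strips.
    X Y : Fin n → ℚ
    X v = ι (left v)
    Y v = ι (y v ℕ.* 3)

    position : Fin n → Point
    position v = X v , Y v

    bend : Fin n → ℕ → Direction → Point
    bend v x δ = ι x , Y v + sign δ

    -- The slanted piece between a vertex and a bend. The parameter starts at the vertex in
    -- whichever direction the piece is traversed.
    record Foot (δ : Direction) (v : Fin n) (x : ℕ) (p : Point) : Set where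
      constructor footing
      field
        {t}  : ℚ
        0≤t  : 0ℚ ≤ t
        t≤1  : t ≤ 1ℚ
        absc : proj₁ p ≡ X v + t * (ι x - X v)
        ordi : proj₂ p ≡ Y v + t * sign δ

    record Shaft (a b : Fin n) (x : ℕ) (p : Point) : Set where
      constructor shaft
      field
        absc  : proj₁ p ≡ ι x
        lower : Y a + 1ℚ ≤ proj₂ p
        upper : proj₂ p ≤ Y b + - 1ℚ

    foot-start : ∀ {δ v x p} → OnSeg p (position v) (bend v x δ) → Foot δ v x p
    foot-start {δ} {v} (t , 0≤t , t≤1 , e₁ , e₂) = footing 0≤t t≤1 e₁
      (trans e₂ (solve 3 (λ h t s → h :+ t :* ((h :+ s) :- h) := h :+ t :* s) refl (Y v) t (sign δ)))

    foot-end : ∀ {δ v x p} → OnSeg p (bend v x δ) (position v) → Foot δ v x p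
    foot-end {δ} {v} {x} (t , 0≤t , t≤1 , e₁ , e₂) =
      footing (complement-nonneg t≤1) (complement-≤1 0≤t) (trans e₁ (lerp-flip (ι x) (X v) t))
        (trans e₂ (solve 3 (λ h t s → (h :+ s) :+ t :* (h :- (h :+ s)) := h :+ (con 1ℚ :- t) :* s)
                  refl (Y v) t (sign δ)))

    level-absc : ∀ c t → c + t * (c - c) ≡ c
    level-absc = solve 2 (λ c t → c :+ t :* (c :- c) := c) refl

    gap : ∀ {v w} → y v ℕ.< y w → Y v + 1ℚ < Y w + - 1ℚ
    gap {v} {w} v<w = begin-strict
      Y v + 1ℚ                          ≡⟨ ℚₚ.+-comm (Y v) 1ℚ ⟩
      1ℚ + Y v                          <⟨ p<1+p _ ⟩
      1ℚ + (1ℚ + Y v)                   ≡⟨ solve 1 (λ h → con 1ℚ :+ (con 1ℚ :+ h)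
                                           := (con 1ℚ :+ (con 1ℚ :+ (con 1ℚ :+ h))) :+ (:- con 1ℚ)) refl (Y v) ⟩
      ι (suc (y v) ℕ.* 3) + - 1ℚ        ≤⟨ ℚₚ.+-monoˡ-≤ (- 1ℚ) (ι-mono-≤ (ℕₚ.*-monoˡ-≤ 3 v<w)) ⟩
      Y w + - 1ℚ                        ∎
      where open ℚₚ.≤-Reasoning

    shaft-up : ∀ {a b x p} → Drawn a b x → OnSeg p (bend a x up) (bend b x down) → Shaft a b x p
    shaft-up {x = x} d (t , 0≤t , t≤1 , e₁ , e₂) = shaft (trans e₁ (level-absc (ι x) t))
      (subst (_ ≤_) (sym e₂) (lerp-lower (ℚₚ.<⇒≤ (gap (upward d))) 0≤t))
      (subst (_≤ _) (sym e₂) (lerp-upper (ℚₚ.<⇒≤ (gap (upward d))) 0≤t t≤1))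

    shaft-down : ∀ {a b x p} → Drawn a b x → OnSeg p (bend b x down) (bend a x up) → Shaft a b x p
    shaft-down {a} {b} {x} d (t , 0≤t , t≤1 , e₁ , e₂) = shaft-up d
      (1ℚ - t , complement-nonneg t≤1 , complement-≤1 0≤t , trans e₁ (lerp-flip (ι x) (ι x) t)
      , trans e₂ (lerp-flip (Y b + - 1ℚ) (Y a + 1ℚ) t))

    foot-range : ∀ {δ v x p} → Foot δ v x p → Y v + - 1ℚ ≤ proj₂ p × proj₂ p ≤ Y v + 1ℚ
    foot-range {δ} {v} (footing 0≤t t≤1 _ e) with sign-≤ δ 0≤t t≤1
    ... | lo , hi = subst (_ ≤_) (sym e) (ℚₚ.+-monoʳ-≤ (Y v) lo) , subst (_≤ _) (sym e) (ℚₚ.+-monoʳ-≤ (Y v) hi)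

    feet-apart : ∀ {δ δ′ v v′ x x′ p} → Foot δ v x p → Foot δ′ v′ x′ p → ¬ (y v ℕ.< y v′)
    feet-apart f f′ v<v′ = ℚₚ.<-irrefl refl (ℚₚ.≤-<-trans (proj₁ (foot-range f′))
      (ℚₚ.≤-<-trans (proj₂ (foot-range f)) (gap v<v′)))

    feet-same : ∀ {δ δ′ v v′ x x′ p} → Foot δ v x p → Foot δ′ v′ x′ p → v ≡ v′
    feet-same {v = v} {v′} f f′ with ℕₚ.<-cmp (y v) (y v′)
    ... | tri< v<v′ _ _ = ⊥-elim (feet-apart f f′ v<v′)
    ... | tri≈ _ eq _ = y-injective eq
    ... | tri> _ _ v′<v = ⊥-elim (feet-apart f′ f v′<v)

    foot-origin : ∀ {δ v x p} (f : Foot δ v x p) → Foot.t f ≡ 0ℚ → p ≡ position v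
    foot-origin {δ} {v} {x} (footing _ _ e₁ e₂) refl = cong₂ _,_
      (trans e₁ (solve 2 (λ a b → a :+ con 0ℚ :* b := a) refl (X v) (ι x - X v)))
      (trans e₂ (solve 2 (λ a b → a :+ con 0ℚ :* b := a) refl (Y v) (sign δ)))

    -- The common height forces equal parameters. For a positive parameter the abscissa grows
    -- strictly with the column, so only the parameter 0 is left.
    feet-meet-aligned : ∀ {δ v x x′ p} → x ≢ x′ → Foot δ v x p → Foot δ v x′ p → p ≡ position v
    feet-meet-aligned {δ} {v} {x} {x′} x≢ f@(footing {t} 0≤t t≤1 e₁ e₂) (footing {s} _ _ e₁′ e₂′)
      with trans (sym (displacement δ (Y v) t)) (trans (cong (λ k → (k - Y v) * sign δ) (trans (sym e₂) e₂′))
             (displacement δ (Y v) s))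
    ... | refl with ℚₚ.<-cmp 0ℚ t
    ...   | tri≈ _ eq _ = foot-origin f (sym eq)
    ...   | tri> _ _ t<0 = ⊥-elim (ℚₚ.<-irrefl refl (ℚₚ.<-≤-trans t<0 0≤t))
    ...   | tri< 0<t _ _ with ℕₚ.<-cmp x x′
    ...     | tri< x<x′ _ _ = ⊥-elim (ℚₚ.<-irrefl (trans (sym e₁) e₁′) (lerp-strict {X v} (ι-mono-< x<x′) 0<t))
    ...     | tri≈ _ eq _ = ⊥-elim (x≢ eq)
    ...     | tri> _ _ x′<x = ⊥-elim (ℚₚ.<-irrefl (trans (sym e₁′) e₁) (lerp-strict {X v} (ι-mono-< x′<x) 0<t))

    feet-meet : ∀ {δ δ′ v x x′ p} → x ≢ x′ → Foot δ v x p → Foot δ′ v x′ p → p ≡ position v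
    feet-meet {up} {up} x≢ f g = feet-meet-aligned x≢ f g
    feet-meet {down} {down} x≢ f g = feet-meet-aligned x≢ f g
    feet-meet {up} {down} {v} x≢ f g = foot-origin f
      (up-down {Y v} (Foot.0≤t f) (Foot.0≤t g) (trans (sym (Foot.ordi f)) (Foot.ordi g)))
    feet-meet {down} {up} {v} x≢ f g = foot-origin g
      (up-down {Y v} (Foot.0≤t g) (Foot.0≤t f) (trans (sym (Foot.ordi g)) (Foot.ordi f)))

    foot-full : ∀ {δ v x x′ p} (f : Foot δ v x p) → 1ℚ ≤ Foot.t f → proj₁ p ≡ ι x′ → x ≡ x′ × p ≡ bend v x δ
    foot-full {δ} {v} {x} {x′} (footing {t} _ t≤1 e₁ e₂) 1≤t e with ℚₚ.≤-antisym t≤1 1≤t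
    ... | refl = ι-injective (trans (sym at-x) e) , cong₂ _,_ at-x
        (trans e₂ (cong (Y v +_) (ℚₚ.*-identityˡ (sign δ))))
      where
      at-x = trans e₁ (solve 2 (λ a b → a :+ con 1ℚ :* (b :- a) := b) refl (X v) (ι x))

    foot-shaft-low : ∀ {δ v x x′ p} → Foot δ v x p → proj₁ p ≡ ι x′ → Y v + 1ℚ ≤ proj₂ p →
                     x ≡ x′ × p ≡ bend v x δ
    foot-shaft-low {up} {v} f@(footing {t} _ _ _ e₂) e le =
      foot-full f (reach-up {Y v} (subst (_ ≤_) e₂ le)) e
    foot-shaft-low {down} {v} (footing {t} 0≤t _ _ e₂) e le =
      ⊥-elim (no-reach-up {Y v} 0≤t (subst (_ ≤_) e₂ le))

    foot-shaft-high : ∀ {δ v x x′ p} → Foot δ v x p → proj₁ p ≡ ι x′ → proj₂ p ≤ Y v + - 1ℚ →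
                      x ≡ x′ × p ≡ bend v x δ
    foot-shaft-high {down} {v} f@(footing {t} _ _ _ e₂) e le =
      foot-full f (reach-down {Y v} (subst (_≤ _) e₂ le)) e
    foot-shaft-high {up} {v} (footing {t} 0≤t _ _ e₂) e le =
      ⊥-elim (no-reach-down {Y v} 0≤t (subst (_≤ _) e₂ le))

    InBar : Fin n → ℕ → Set
    InBar v x = left v ℕ.≤ x × x ℕ.≤ right v

    -- If `v` is below `a` or above `b`, the heights disagree. If `v` is an end of the edge, the
    -- foot reaches the shaft only with parameter 1, at the bend. If `v` lies between, the foot
    -- stays over the bar of `v`, and meeting the shaft there contradicts `clear`.
    foot-shaft : ∀ {δ v x a b x′ p} → Foot δ v x p → InBar v x → Drawn a b x′ → Shaft a b x′ p →
                 (v ≡ a ⊎ v ≡ b) × x ≡ x′ × p ≡ bend v x δ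
    foot-shaft {v = v} {x} {a} {b} {x′} f (l≤x , x≤r) d (shaft e lo hi) with ℕₚ.<-cmp (y v) (y a)
    ... | tri< v<a _ _ = ⊥-elim (ℚₚ.<-irrefl refl (ℚₚ.≤-<-trans (ℚₚ.≤-trans lo (proj₂ (foot-range f)))
            (ℚₚ.<-≤-trans (gap v<a) (ℚₚ.+-monoʳ-≤ (Y a) -1≤1))))
    ... | tri≈ _ eq _ with y-injective eq
    ...   | refl = inj₁ refl , foot-shaft-low f e lo
    foot-shaft {v = v} {x} {a} {b} {x′} f (l≤x , x≤r) d (shaft e lo hi) | tri> _ _ a<v with ℕₚ.<-cmp (y v) (y b)
    ... | tri≈ _ eq _ with y-injective eq
    ...   | refl = inj₂ refl , foot-shaft-high f e hi
    foot-shaft {v = v} {x} {a} {b} {x′} f (l≤x , x≤r) d (shaft e lo hi) | tri> _ _ a<v | tri> _ _ b<v =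
      ⊥-elim (ℚₚ.<-irrefl refl (ℚₚ.≤-<-trans (ℚₚ.≤-trans (proj₁ (foot-range f)) hi)
        (ℚₚ.≤-<-trans (ℚₚ.+-monoʳ-≤ (Y b) -1≤1) (gap b<v))))
    foot-shaft {v = v} {x} {a} {b} {x′} f (l≤x , x≤r) d (shaft e lo hi) | tri> _ _ a<v | tri< v<b _ _ =
      ⊥-elim (clear d a<v v<b
        ( ι-cancel-≤ (subst (X v ≤_) at (lerp-lower (ι-mono-≤ l≤x) (Foot.0≤t f)))
        , ι-cancel-≤ (subst (_≤ ι (right v)) at
            (ℚₚ.≤-trans (lerp-upper (ι-mono-≤ l≤x) (Foot.0≤t f) (Foot.t≤1 f)) (ι-mono-≤ x≤r)))))
      where
      at = trans (sym (Foot.absc f)) e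

    Runs : Direction → Fin n → Fin n → ℕ → Set
    Runs up u v x = Drawn u v x
    Runs down u v x = Drawn v u x

    polyline : Direction → Fin n → Fin n → ℕ → List Point
    polyline δ u v x = position u ∷ bend u x δ ∷ bend v x (opposite δ) ∷ position v ∷ []

    -- By `column` a column carries only one edge; quantifying over it in `along` frees the
    -- statement from the direction of traversal.
    data OnStrand (u v : Fin n) (x : ℕ) (p : Point) : Set where
      nearby : ∀ {δ w} → w ≡ u ⊎ w ≡ v → InBar w x → Foot δ w x p → OnStrand u v x p
      along  : ∀ {δ} → Runs δ u v x → (∀ {a b} → Drawn a b x → Shaft a b x p) → OnStrand u v x p

    runs-start : ∀ δ {u v x} → Runs δ u v x → InBar u x
    runs-start up = foot
    runs-start down = head

    runs-end : ∀ δ {u v x} → Runs δ u v x → InBar v x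
    runs-end up = head
    runs-end down = foot

    runs-distinct : ∀ δ {u v x} → Runs δ u v x → u ≢ v
    runs-distinct up d refl = ℕₚ.<-irrefl refl (upward d)
    runs-distinct down d refl = ℕₚ.<-irrefl refl (upward d)

    runs-shaft : ∀ δ {u v x p} → Runs δ u v x → OnSeg p (bend u x δ) (bend v x (opposite δ)) →
                 ∀ {a b} → Drawn a b x → Shaft a b x p
    runs-shaft up r s d with column r d
    ... | refl , refl = shaft-up r s
    runs-shaft down r s d with column r d
    ... | refl , refl = shaft-down r s

    on-strand : ∀ δ {u v x p} → Runs δ u v x → OnPoly p (polyline δ u v x) → OnStrand u v x p
    on-strand δ r (here s) = nearby (inj₁ refl) (runs-start δ r) (foot-start {δ} s)
    on-strand δ r (there (here s)) = along {δ = δ} r (runs-shaft δ r s)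
    on-strand δ r (there (there (here s))) = nearby (inj₂ refl) (runs-end δ r) (foot-end {opposite δ} s)

    runs-drawn : ∀ δ {u v x} → Runs δ u v x →
      ∃ λ a → ∃ λ b → Drawn a b x × ((a ≡ u × b ≡ v) ⊎ (a ≡ v × b ≡ u))
    runs-drawn up r = _ , _ , r , inj₁ (refl , refl)
    runs-drawn down r = _ , _ , r , inj₂ (refl , refl)

    runs-incident : ∀ {u v a b w : Fin n} → (a ≡ u × b ≡ v) ⊎ (a ≡ v × b ≡ u) → w ≡ a ⊎ w ≡ b → w ≡ u ⊎ w ≡ v
    runs-incident (inj₁ (refl , refl)) i = i
    runs-incident (inj₂ (refl , refl)) (inj₁ i) = inj₂ i
    runs-incident (inj₂ (refl , refl)) (inj₂ i) = inj₁ i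

    foot-along : ∀ {δ δ′ u v w x x′ p} → Foot δ w x p → InBar w x → Runs δ′ u v x′ →
                 (∀ {a b} → Drawn a b x′ → Shaft a b x′ p) → (w ≡ u ⊎ w ≡ v) × x ≡ x′ × p ≡ bend w x δ
    foot-along {δ′ = δ′} f inside r s with runs-drawn δ′ r
    ... | _ , _ , d , ends with foot-shaft f inside d (s d)
    ...   | inc , rest = runs-incident ends inc , rest

    -- Makes vertices a special case of feet, with parameter 0, so that the facts about feet also
    -- show that edges avoid other vertices.
    foot-position : ∀ v → Foot up v (left v) (position v)
    foot-position v = footing {t = 0ℚ} ℚₚ.≤-refl (ℚₚ.<⇒≤ 0<1)
      (solve 2 (λ a b → a := a :+ con 0ℚ :* b) refl (X v) (ι (left v) - X v))
      (solve 1 (λ a → a := a :+ con 0ℚ :* con 1ℚ) refl (Y v))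

    strand-avoids : ∀ {u v w x} → OnStrand u v x (position w) → w ≡ u ⊎ w ≡ v
    strand-avoids {u} {v} {w} (nearby inc _ f) =
      subst (λ z → z ≡ u ⊎ z ≡ v) (sym (feet-same (foot-position w) f)) inc
    strand-avoids {w = w} (along {δ} r s) =
      proj₁ (foot-along {δ′ = δ} (foot-position w) (ℕₚ.≤-refl , left≤right w) r s)

    -- Across different columns a shaft meets neither a foot nor a shaft, and two feet meet only at
    -- a common vertex.
    strands-meet : ∀ {u v x u′ v′ x′ p} → x ≢ x′ → OnStrand u v x p → OnStrand u′ v′ x′ p →
                   Σ (Fin n) λ w → (w ≡ u ⊎ w ≡ v) × (w ≡ u′ ⊎ w ≡ v′) × p ≡ position w
    strands-meet x≢ (nearby {w = w} i _ f) (nearby i′ _ f′) with feet-same f f′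
    ... | refl = w , i , i′ , feet-meet x≢ f f′
    strands-meet x≢ (nearby _ inside f) (along {δ} r s) =
      ⊥-elim (x≢ (proj₁ (proj₂ (foot-along {δ′ = δ} f inside r s))))
    strands-meet x≢ (along {δ} r s) (nearby _ inside f) =
      ⊥-elim (x≢ (sym (proj₁ (proj₂ (foot-along {δ′ = δ} f inside r s)))))
    strands-meet x≢ (along {δ} r s) (along {δ′} r′ s′) with runs-drawn δ r | runs-drawn δ′ r′
    ... | _ , _ , d , _ | _ , _ , d′ , _ =
      ⊥-elim (x≢ (ι-injective (trans (sym (Shaft.absc (s d))) (Shaft.absc (s′ d′)))))

    same-column : ∀ δ δ′ {u v u′ v′ x} → Runs δ u v x → Runs δ′ u′ v′ x →
                  (u ≡ u′ × v ≡ v′) ⊎ (u ≡ v′ × v ≡ u′)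
    same-column up up r r′ = inj₁ (column r r′)
    same-column up down r r′ = inj₂ (column r r′)
    same-column down up r r′ = let p , q = column r r′ in inj₂ (q , p)
    same-column down down r r′ = let p , q = column r r′ in inj₁ (q , p)

    position-injective : ∀ u v → position u ≡ position v → u ≡ v
    position-injective u v eq =
      y-injective (ℕₚ.*-cancelʳ-≡ (y u) (y v) 3 (ι-injective (cong proj₂ eq)))

    bend≢position : ∀ δ {v x} → position v ≢ bend v x δ
    bend≢position up {v} eq = ℚₚ.<⇒≢ (p<1+p (Y v)) (trans (cong proj₂ eq) (ℚₚ.+-comm (Y v) 1ℚ))
    bend≢position down {v} eq = ℚₚ.<⇒≢ (p<1+p (Y v + - 1ℚ)) (trans (sym (cong proj₂ eq))
      (solve 1 (λ h → h := con 1ℚ :+ (h :+ (:- con 1ℚ))) refl (Y v)))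

    bends-distinct : ∀ δ {u v x} → Runs δ u v x → bend u x δ ≢ bend v x (opposite δ)
    bends-distinct up r eq = ℚₚ.<⇒≢ (gap (upward r)) (cong proj₂ eq)
    bends-distinct down r eq = ℚₚ.<⇒≢ (gap (upward r)) (sym (cong proj₂ eq))

    -- Each foot meets the shaft only in their bend, and the two feet lie in the disjoint strips of
    -- different vertices.
    polyline-simple : ∀ δ {u v x} → Runs δ u v x → SimplePoly (polyline δ u v x)
    polyline-simple δ {u} {v} {x} r =
      (bend≢position δ {x = x} ∷ bends-distinct δ r ∷ (bend≢position (opposite δ) {x = x} ∘ sym) ∷ []) , pairs
      where
      pairs : ∀ i j → toℕ i ℕ.< toℕ j → _
      pairs zero (suc zero) _ =
        (λ _ p s s′ → proj₂ (proj₂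
          (foot-along {δ′ = δ} (foot-start {δ} {x = x} s) (runs-start δ r) r (runs-shaft δ r s′)))) ,
        λ { (s≤s ()) }
      pairs (suc zero) (suc (suc zero)) _ =
        (λ _ p s s′ → proj₂ (proj₂
          (foot-along {δ′ = δ} (foot-end {opposite δ} {x = x} s′) (runs-end δ r) r (runs-shaft δ r s)))) ,
        λ { (s≤s (s≤s ())) }
      pairs zero (suc (suc zero)) _ =
        (λ ()) , λ _ p (s , s′) → runs-distinct δ r
        (feet-same (foot-start {δ} {x = x} s) (foot-end {opposite δ} {x = x} s′))
      pairs zero zero ()
      pairs (suc zero) zero ()
      pairs (suc zero) (suc zero) (s≤s ())
      pairs (suc (suc zero)) zero ()
      pairs (suc (suc zero)) (suc zero) (s≤s ())
      pairs (suc (suc zero)) (suc (suc zero)) (s≤s (s≤s ()))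

open Drawings

-- From the graph to its plane drawing.

module _ (G : Graph) where
  open Graph G

  -- Each edge of `G` occurs in both orientations; the two copies count as parallel edges.
  edges : Edges {n}
  edges = map (λ (u , v) → u , v , 1)
    (filter (λ (u , v) → adj u v Boolₚ.≟ true) (cartesianProduct (allFin n) (allFin n)))

  adjacent⇒∈edges : ∀ {u v} → Adj G u v → (u , v , 1) ∈ edges
  adjacent⇒∈edges uv = ∈-map⁺ _ (∈-filter⁺ _ (∈-cartesianProduct⁺ (∈-allFin _) (∈-allFin _)) uv)

  ∈edges⇒adjacent : ∀ {u v w} → (u , v , w) ∈ edges → Adj G u v × w ≡ 1
  ∈edges⇒adjacent p with ∈-map⁻ _ p
  ... | _ , q , refl = proj₂ (∈-filter⁻ (λ (u , v) → adj u v Boolₚ.≟ true)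
    {xs = cartesianProduct (allFin n) (allFin n)} q) , refl

  link⇒adjacent : ∀ {u v w} → Link edges u v w → Adj G u v × w ≡ 1
  link⇒adjacent (inj₁ p) = ∈edges⇒adjacent p
  link⇒adjacent {u} {v} (inj₂ p) = let vu , eq = ∈edges⇒adjacent p in trans (adj-sym u v) vu , eq

  edges-loopless : Loopless edges
  edges-loopless {v} p with trans (sym (adj-irrefl v)) (proj₁ (∈edges⇒adjacent p))
  ... | ()

  -- All weights are 1, so the weight is the number of links, which for a closed path is the number
  -- of vertices. The end `v` is kept general for the induction.
  path⇒cycle : ∀ {u v is w} → Path (Link edges) u v is w →
               Linked (Adj G) (u ∷ is) × Adj G (lastOf G u is) v × w ≡ suc (length is)
  path⇒cycle [ l ] = [-] , link⇒adjacent l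
  path⇒cycle (l ∷ p) with path⇒cycle p | link⇒adjacent l
  ... | ls , last , refl | a , refl = (a ∷ ls) , last , refl

  edges-admissible : (∀ (c : Cycle G) → Admissible (cycleLength G c)) → CyclesAdmissible (Link edges)
  edges-admissible good {u} {is} p unique 2≤ with path⇒cycle p
  ... | ls , last , refl = good record
    { verts = u ∷ is ; long = s≤s 2≤ ; distinct = unique ; path = ls ; closed = last }

  module _ (rep : Represents edges) where
    open Represents rep
    open Geometry layout

    bendsOf : ∀ {u v} → Shown u v → List Point
    bendsOf {u} {v} (x , inj₁ _) = bend u x up ∷ bend v x down ∷ []
    bendsOf {u} {v} (x , inj₂ _) = bend u x down ∷ bend v x up ∷ []

    bendsAt : Fin n → Fin n → List Point
    bendsAt u v with adj u v Boolₚ.≟ true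
    ... | yes uv = bendsOf (shown (adjacent⇒∈edges uv))
    -- An arbitrary value: only arcs of edges are ever examined.
    ... | no _ = []

    Strand : Fin n → Fin n → Set
    Strand u v = ∃ λ δ → ∃ λ x → Runs δ u v x × arc G position bendsAt u v ≡ polyline δ u v x

    strand : ∀ u v → Edge G u v → Strand u v
    strand u v (_ , uv) with adj u v Boolₚ.≟ true
    ... | no ¬uv = ⊥-elim (¬uv uv)
    ... | yes uv′ with shown (adjacent⇒∈edges uv′)
    ...   | x , inj₁ d = up , x , d , refl
    ...   | x , inj₂ d = down , x , d , refl

    drawing : PlaneDrawing G
    drawing = record
      { pos = position ; pos-inj = position-injective ; bends = bendsAt
      ; arc-simple = simple ; arc-avoids = avoids ; arcs-disjoint = disjoint }
      where
      simple : ∀ u v → Edge G u v → SimplePoly (arc G position bendsAt u v)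
      simple u v e with strand u v e
      ... | δ , x , r , eq = subst SimplePoly (sym eq) (polyline-simple δ r)

      avoids : ∀ u v w → Edge G u v → OnPoly (position w) (arc G position bendsAt u v) → w ≡ u ⊎ w ≡ v
      avoids u v w e on with strand u v e
      ... | δ , x , r , eq = strand-avoids (on-strand δ r (subst (OnPoly (position w)) eq on))

      disjoint : ∀ u v u′ v′ → Edge G u v → Edge G u′ v′ → ¬ (u ≡ u′ × v ≡ v′) →
                 ∀ p → OnPoly p (arc G position bendsAt u v) → OnPoly p (arc G position bendsAt u′ v′) →
                 ∃ λ w → (w ≡ u ⊎ w ≡ v) × (w ≡ u′ ⊎ w ≡ v′) × p ≡ position w
      disjoint u v u′ v′ e e′ distinct p on on′ with strand u v e | strand u′ v′ e′
      ... | δ , x , r , eq | δ′ , x′ , r′ , eq′ with x ℕₚ.≟ x′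
      ...   | no x≢x′ = strands-meet x≢x′ (on-strand δ r (subst (OnPoly p) eq on))
                          (on-strand δ′ r′ (subst (OnPoly p) eq′ on′))
      ...   | yes refl with same-column δ δ′ r r′
      ...     | inj₁ same = ⊥-elim (distinct same)
      -- Edges are listed with the smaller end first, so neither is the other reversed.
      ...     | inj₂ (refl , refl) = ⊥-elim (ℕₚ.<-asym (proj₁ e) (proj₁ e′))

mainTheorem20 : (G : Graph) → Inε23 G → Planar G
mainTheorem20 G (_ , good , _) =
  drawing G (represent _ (edges G) ℕₚ.≤-refl (edges-loopless G) (edges-admissible G good))
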